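{- $R_{\mathrm{PPM}^*}(S) = 0$, i.e. $\limsup_{m\to\infty} |\mathrm{PPM}^*(S\upharpoonright m)|/m = 0$.
   Context: Strings are binary, indexed from $0$; $x[i..j]$ is bits $i$ through $j$; $x^t$ is $t$-fold concatenation; $S\upharpoonright m$ is the length-$m$ prefix of a sequence $S$; $\mathrm{occ}(w,x)$ is the number of positions at which $w$ occurs as a substring of $x$ (for $w$ empty, $|x|+1$). For $n\ge1$, $db(n)$ is the lexicographically least de Bruijn string of order $n$ (length $2^n$, cyclically containing every length-$n$ binary string exactly once), built by: start with $x=1^{n-1}$; while possible append a bit (preferring $0$) keeping every length-$n$ substring of $x$ unique; then delete the prefix $1^{n-1}$. $db_i(n)=db(n)[i..2^n-1]\,db(n)[0..i-1]$ and $db_i^t(n)$ is its $t$-fold concatenation. For $n=2^st$ with $t$ odd, $S_n = db_0^t(n)\,db_1^t(n)\cdots db_{2^s-1}^t(n)$; $S=S_1S_2S_3\cdots$. PPM* (escape Method C, no exclusion). If $x$ is the input read so far, the model consists of $\lambda$ and every nonempty string $c$ such that $\mathrm{occ}(cb,x)\ge1$ for some bit $b$ and $c$ with its last bit removed occurs at least twice in $x$. For context $c$: count of bit $b$ is $\mathrm{occ}(cb,x)$; escape count $e(c)$ = number of bits with positive count; with $T$ = sum of the two counts and $e(c)$, bit $b$ gets probability $\mathrm{occ}(cb,x)/T$ and escape gets $e(c)/T$; $c$ is deterministic if $e(c)=1$. Relevant contexts are model contexts that are suffixes of $x$. To encode the next bit $b$: the current context is the shortest deterministic relevant context if one exists,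 else the longest relevant context. While the current context $c$ has count $0$ for $b$: an escape is emitted with probability $e(c)/T$ (if $c$ has any prediction) and the current context becomes the longest relevant context shorter than $c$; if $c=\lambda$, $b$ is emitted with probability $1/2$ and encoding of $b$ ends. When the current context has positive count for $b$, $b$ is emitted with its probability; then the model is updated. For a finite string $y$, let $P(y)$ be the product of all probabilities emitted while encoding $y$; $\mathrm{PPM}^*(y)$ is the arithmetic code of $y$, a binary string of length between $-\log_2 P(y)$ and $-\log_2 P(y) + 2$ (exact interval arithmetic, at most one bit of overhead). For a compressor $T$ and sequence $S$, $R_T(S) = \limsup_{m\to\infty} |T(S\upharpoonright m)|/m$. -}

module Defs where

open import Data.Bool using (Bool; true; false; if_then_else_; _∧_; _∨_; not)
open import Data.Nat using (ℕ; zero; suc; _+_; _*_; _∸_; _^_; _≤ᵇ_; _<ᵇ_; _≡ᵇ_)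
open import Data.Nat.DivMod using (_/_; _%_)
open import Data.List using (List; []; _∷_; _++_; length; take; drop; replicate; concat; map; upTo; reverse)
open import Data.Maybe using (Maybe; just; nothing)
open import Data.Product using (_×_; _,_)

Str : Set
Str = List Bool

eqB : Bool → Bool → Bool
eqB a b = if a then b else not b

bit : Bool → ℕ
bit true  = 1
bit false = 0

isPrefix : Str → Str → Bool
isPrefix []      _       = true
isPrefix (_ ∷ _) []      = false
isPrefix (a ∷ w) (b ∷ x) = eqB a b ∧ isPrefix w x

-- occ w x : number of positions of x at which w occurs
-- (for w empty this is |x| + 1).
occ : Str → Str → ℕ
occ w []       = bit (isPrefix w [])
occ w (a ∷ x)  = bit (isPrefix w (a ∷ x)) + occ w x

dropLast : Str → Str
dropLast []           = []
dropLast (_ ∷ [])     = []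
dropLast (a ∷ b ∷ x)  = a ∷ dropLast (b ∷ x)

allL : (ℕ → Bool) → List ℕ → Bool
allL p []       = true
allL p (i ∷ is) = p i ∧ allL p is

uniqueWindows : ℕ → Str → Bool
uniqueWindows n y =
  if length y <ᵇ n then true
  else allL (λ i → occ (take n (drop i y)) y ≡ᵇ 1) (upTo (suc (length y ∸ n)))

step : ℕ → Str → Maybe Str
step n x =
  if uniqueWindows n (x ++ (false ∷ [])) then just (x ++ (false ∷ []))
  else (if uniqueWindows n (x ++ (true ∷ [])) then just (x ++ (true ∷ [])) else nothing)

build : ℕ → ℕ → Str → Str
build n zero    x = x
build n (suc f) x with step n x
... | nothing = x
... | just x' = build n f x'

-- db(n): start with 1^{n-1}, append greedily while possible (at most 2^n
-- appends are possible), then delete the prefix 1^{n-1}.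
db : ℕ → Str
db n = drop (n ∸ 1) (build n (2 ^ n) (replicate (n ∸ 1) true))

dbRot : ℕ → ℕ → Str
dbRot n i = drop i (db n) ++ take i (db n)

pow : Str → ℕ → Str
pow w t = concat (replicate t w)

-- 2-adic valuation and odd part (fuel argument ≥ n suffices)
val2F : ℕ → ℕ → ℕ
val2F zero    n = 0
val2F (suc f) n = if (0 <ᵇ n) ∧ (n % 2 ≡ᵇ 0) then suc (val2F f (n / 2)) else 0

oddF : ℕ → ℕ → ℕ
oddF zero    n = n
oddF (suc f) n = if (0 <ᵇ n) ∧ (n % 2 ≡ᵇ 0) then oddF f (n / 2) else n

val2 : ℕ → ℕ
val2 n = val2F n n

oddPart : ℕ → ℕ
oddPart n = oddF n n

Sblock : ℕ → Str
Sblock n = concat (map (λ i → pow (dbRot n i) (oddPart n)) (upTo (2 ^ val2 n)))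

-- S ↾ m : length-m prefix of S = S_1 S_2 S_3 ...
-- (each S_n is nonempty, so S_1 ... S_m has length ≥ m)
prefixS : ℕ → Str
prefixS m = take m (concat (map (λ i → Sblock (suc i)) (upTo m)))

-- PPM* (escape method C, no exclusion)

-- nonnegative fractions as (numerator , denominator), unreduced
Frac : Set
Frac = ℕ × ℕ

_⊗_ : Frac → Frac → Frac
(a , b) ⊗ (c , d) = (a * c , b * d)

firstWhere : (ℕ → Bool) → List ℕ → Maybe ℕ
firstWhere p []       = nothing
firstWhere p (i ∷ is) = if p i then just i else firstWhere p is

module PPM (x : Str) where
  lenx : ℕ
  lenx = length x

  -- the suffix of x of length ℓ (for ℓ ≤ |x|)
  suf : ℕ → Str
  suf ℓ = drop (lenx ∸ ℓ) x

  cnt : ℕ → Bool → ℕ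
  cnt ℓ b = occ (suf ℓ ++ (b ∷ [])) x

  esc : ℕ → ℕ
  esc ℓ = bit (0 <ᵇ cnt ℓ false) + bit (0 <ᵇ cnt ℓ true)

  total : ℕ → ℕ
  total ℓ = cnt ℓ false + cnt ℓ true + esc ℓ

  isModel : ℕ → Bool
  isModel zero    = true
  isModel (suc k) = ((0 <ᵇ cnt (suc k) false) ∨ (0 <ᵇ cnt (suc k) true))
                    ∧ (1 <ᵇ occ (dropLast (suf (suc k))) x)

  relevant : ℕ → Bool
  relevant ℓ = (ℓ ≤ᵇ lenx) ∧ isModel ℓ

  deterministic : ℕ → Bool
  deterministic ℓ = esc ℓ ≡ᵇ 1

  startLen : ℕ
  startLen with firstWhere (λ ℓ → relevant ℓ ∧ deterministic ℓ) (upTo (suc lenx))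
  ... | just ℓ  = ℓ
  ... | nothing with firstWhere relevant (reverse (upTo (suc lenx)))
  ...   | just ℓ  = ℓ
  ...   | nothing = 0

  -- escape factor (only emitted if the context has a prediction)
  escFactor : ℕ → Frac
  escFactor ℓ = if 0 <ᵇ esc ℓ then (esc ℓ , total ℓ) else (1 , 1)

  -- search k: current context is the longest relevant context of
  -- length ≤ k; returns the product of probabilities emitted from there.
  search : Bool → ℕ → Frac
  search b zero =
    if 0 <ᵇ cnt 0 b then (cnt 0 b , total 0)
    else escFactor 0 ⊗ (1 , 2)
  search b (suc k) =
    if relevant (suc k)
    then (if 0 <ᵇ cnt (suc k) b then (cnt (suc k) b , total (suc k))
          else escFactor (suc k) ⊗ search b k)
    else search b k

  probBit : Bool → Frac
  probBit b = search b startLen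

Pgo : Str → Str → Frac
Pgo x []       = (1 , 1)
Pgo x (b ∷ ys) = PPM.probBit x b ⊗ Pgo (x ++ (b ∷ [])) ys

P : Str → Frac
P y = Pgo [] y

{-# OPTIONS --safe #-}

-- Only repetitiveness of S matters. Every N-window of d = db N occurs in it only once. Put
-- H = N + N^3. Stage N consists of 2N substrings of d. A position of the stage is regular if the
-- H bits before it and its own bit b form a window e b of d; all but about 2NH positions are.
--
-- Stage N - 1 contains every string of length N - 2, so every context of length N - 3 has been
-- followed by both bits, and a bit costs at most 2 log₂ (q + 2), where q is the number of
-- occurrences of the current context of that length; in particular it costs O(N).
--
-- If e has never been followed by the other bit and e b has occurred r ≥ 1 times, then the
-- shortest deterministic context is a suffix of e, has count at least r and predicts b: the cost
-- is at most log₂ ((r + 1) / r). Over the at most N repetitions of each of the 2^N windows this is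
-- o(N) per window. The first visits of the windows cost O(2^N) plus a small multiple of N 2^N,
-- because the numbers q add up to O(N 2^N) over all windows.
--
-- Finally, two positions of the text at which an H-window of d is followed by the wrong bit are
-- more than H - N = N^3 apart, so few windows e have a wrong continuation and their positions
-- are negligible even at cost O(N) each.
module Submission where

open import Defs
open import Data.Bool using (Bool; true; false; not; _∧_; _∨_; T; if_then_else_)
open import Data.Bool.Properties using (not-involutive)
open import Data.Empty using (⊥; ⊥-elim)
open import Data.List using ([]; _∷_; [_]; _++_; length; take; drop; replicate; concat; map; upTo; applyUpTo; downFrom; reverse)
open import Data.List.Properties
  using (++-assoc; ++-identityʳ; ++-cancelʳ; length-++; length-replicate; length-take; length-drop; length-upTo;
         take++drop≡id; take-all; take-[]; drop-drop; map-++; concat-++; upTo-∷ʳ; reverse-upTo)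
open import Data.Maybe using (just; nothing)
open import Data.Nat
open import Data.Nat.DivMod using (_/_; _%_; m≡m%n+[m/n]*n; m%n<n; m/n*n≤m)
open import Data.Nat.Properties
open import Data.Nat.Tactic.RingSolver using (solve-∀)
open import Data.Product using (∃; ∃₂; _×_; _,_; proj₁; proj₂)
open import Data.Sum using (_⊎_; inj₁; inj₂)
open import Function using (_∘_)
open import Relation.Binary.PropositionalEquality hiding ([_])
open import Relation.Nullary using (yes; no)

-- Occurrence counts

-- A stage has `N * 2 ^ N` bits, so `2 ^ N` first visits at O(N) bits each would already be linear
-- in the text. This is why their cost is traded for a bound linear in `q` whose slope, of order
-- `1 / 2 ^ a`, can be made as small as desired. The accuracy is fixed in advance: for the target
-- `1 / k`, code lengths are integers in units of `1 / K` bit with `K = 16 * k`. The sum of log₂ ((r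
-- + 1) / r) is replaced by `K` units for each of the first `2 * K` repetitions and one unit for
-- each later one. The exponent 3 in `H` meets two demands. Each of the `2 * N` substrings has `H`
-- irregular bits of cost O(N), which allows `H` to be any polynomial. A wrong continuation anywhere
-- in the text can spoil one position in every substring, so it costs O(N^2); the gap `N ^ 3` leaves
-- at most about `2 * N * 2 ^ N / N ^ 3` of them, which makes O(2^N) in all.

bit≤1 : ∀ b → bit b ≤ 1
bit≤1 true  = ≤-refl
bit≤1 false = z≤n

bit-mono : ∀ {a b} → (a ≡ true → b ≡ true) → bit a ≤ bit b
bit-mono {false}        f = z≤n
bit-mono {true} {true}  f = ≤-refl
bit-mono {true} {false} f with () ← f refl

0<bit⇒true : ∀ {b} → 1 ≤ bit b → b ≡ true
0<bit⇒true {true} _ = refl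

isPrefix-++ : ∀ w β → isPrefix w (w ++ β) ≡ true
isPrefix-++ []          β = refl
isPrefix-++ (true ∷ w)  β = isPrefix-++ w β
isPrefix-++ (false ∷ w) β = isPrefix-++ w β

isPrefix-sound : ∀ w x → isPrefix w x ≡ true → ∃ λ β → x ≡ w ++ β
isPrefix-sound []          x           _ = x , refl
isPrefix-sound (true ∷ w)  (true ∷ x)  p with β , q ← isPrefix-sound w x p = β , cong (true ∷_) q
isPrefix-sound (false ∷ w) (false ∷ x) p with β , q ← isPrefix-sound w x p = β , cong (false ∷_) q

isPrefix-shorten : ∀ w u x → isPrefix (w ++ u) x ≡ true → isPrefix w x ≡ true
isPrefix-shorten w u x p with β , refl ← isPrefix-sound (w ++ u) x p =
  subst (λ y → isPrefix w y ≡ true) (sym (++-assoc w u β)) (isPrefix-++ w (u ++ β))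

isPrefix-extend : ∀ w x y → isPrefix w x ≡ true → isPrefix w (x ++ y) ≡ true
isPrefix-extend w x y p with β , refl ← isPrefix-sound w x p =
  subst (λ z → isPrefix w z ≡ true) (sym (++-assoc w β y)) (isPrefix-++ w (β ++ y))

isPrefix-long : ∀ w x → length x < length w → isPrefix w x ≡ false
isPrefix-long (a ∷ w)     []          _       = refl
isPrefix-long (true ∷ w)  (true ∷ x)  (s≤s p) = isPrefix-long w x p
isPrefix-long (true ∷ w)  (false ∷ x) (s≤s p) = refl
isPrefix-long (false ∷ w) (true ∷ x)  (s≤s p) = refl
isPrefix-long (false ∷ w) (false ∷ x) (s≤s p) = isPrefix-long w x p

isPrefix-++-short : ∀ w x y → length w ≤ length x → isPrefix w (x ++ y) ≡ isPrefix w x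
isPrefix-++-short []          x           y _       = refl
isPrefix-++-short (true ∷ w)  (true ∷ x)  y (s≤s p) = isPrefix-++-short w x y p
isPrefix-++-short (true ∷ w)  (false ∷ x) y (s≤s p) = refl
isPrefix-++-short (false ∷ w) (true ∷ x)  y (s≤s p) = refl
isPrefix-++-short (false ∷ w) (false ∷ x) y (s≤s p) = isPrefix-++-short w x y p

isPrefix-same-length : ∀ w x → length w ≡ length x → isPrefix w x ≡ true → w ≡ x
isPrefix-same-length []          []          _ _ = refl
isPrefix-same-length (true ∷ w)  (true ∷ x)  l p = cong (true ∷_) (isPrefix-same-length w x (suc-injective l) p)
isPrefix-same-length (false ∷ w) (false ∷ x) l p = cong (false ∷_) (isPrefix-same-length w x (suc-injective l) p)

occ-pointwise : ∀ w w′ → (∀ x → isPrefix w x ≡ true → isPrefix w′ x ≡ true) →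
                ∀ x → occ w x ≤ occ w′ x
occ-pointwise w w′ f []      = bit-mono (f [])
occ-pointwise w w′ f (a ∷ x) = +-mono-≤ (bit-mono (f (a ∷ x))) (occ-pointwise w w′ f x)

occ-shortenʳ : ∀ w u x → occ (w ++ u) x ≤ occ w x
occ-shortenʳ w u = occ-pointwise (w ++ u) w (isPrefix-shorten w u)

occ-≤-++ʳ : ∀ w x y → occ w x ≤ occ w (x ++ y)
occ-≤-++ʳ w []      []      = ≤-refl
occ-≤-++ʳ w []      (b ∷ y) = ≤-trans (bit-mono (isPrefix-extend w [] (b ∷ y))) (m≤m+n _ _)
occ-≤-++ʳ w (a ∷ x) y       = +-mono-≤ (bit-mono (isPrefix-extend w (a ∷ x) y)) (occ-≤-++ʳ w x y)

occ-≤-++ˡ : ∀ w y x → occ w x ≤ occ w (y ++ x)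
occ-≤-++ˡ w []      x = ≤-refl
occ-≤-++ˡ w (a ∷ y) x = ≤-trans (occ-≤-++ˡ w y x) (m≤n+m _ _)

occ-isPrefix : ∀ w x → bit (isPrefix w x) ≤ occ w x
occ-isPrefix w []      = ≤-refl
occ-isPrefix w (a ∷ x) = m≤m+n _ _

occ-long : ∀ w x → length x < length w → occ w x ≡ 0
occ-long w []      p rewrite isPrefix-long w [] p = refl
occ-long w (a ∷ x) p rewrite isPrefix-long w (a ∷ x) p = occ-long w x (<-trans (n<1+n _) p)

occ-factor : ∀ α w β → 1 ≤ occ w (α ++ w ++ β)
occ-factor α w β = begin
  1                             ≡⟨ cong bit (sym (isPrefix-++ w β)) ⟩
  bit (isPrefix w (w ++ β))     ≤⟨ occ-isPrefix w (w ++ β) ⟩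
  occ w (w ++ β)                ≤⟨ occ-≤-++ˡ w α (w ++ β) ⟩
  occ w (α ++ w ++ β)           ∎
  where open ≤-Reasoning

occ⇒factor : ∀ w x → 1 ≤ occ w x → ∃₂ λ α β → x ≡ α ++ w ++ β
occ⇒factor w [] p with β , q ← isPrefix-sound w [] (0<bit⇒true p) = [] , β , q
occ⇒factor w (a ∷ x) p with isPrefix w (a ∷ x) in eq
... | true  with β , q ← isPrefix-sound w (a ∷ x) eq = [] , β , q
... | false with α , β , q ← occ⇒factor w x p = a ∷ α , β , cong (a ∷_) q

-- An occurrence of `w` is either preceded by a bit or sits at the start of `x`; the last summand on
-- the left is the latter.
occ-∷-split : ∀ w x → occ (false ∷ w) x + occ (true ∷ w) x + bit (isPrefix w x) ≡ occ w x
occ-∷-split w [] = refl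
occ-∷-split w (true ∷ x) = begin
  F₀ + (p + T₁) + q     ≡⟨ cong (_+ q) (trans (sym (+-assoc F₀ p T₁)) (cong (_+ T₁) (+-comm F₀ p))) ⟩
  p + F₀ + T₁ + q       ≡⟨ cong (_+ q) (trans (+-assoc p F₀ T₁) (+-comm p (F₀ + T₁))) ⟩
  F₀ + T₁ + p + q       ≡⟨ +-comm (F₀ + T₁ + p) q ⟩
  q + (F₀ + T₁ + p)     ≡⟨ cong (q +_) (occ-∷-split w x) ⟩
  q + occ w x         ∎
  where
  open ≡-Reasoning
  p = bit (isPrefix w x)
  q = bit (isPrefix w (true ∷ x))
  F₀ = occ (false ∷ w) x
  T₁ = occ (true ∷ w) x
occ-∷-split w (false ∷ x) = begin
  p + F₀ + T₁ + q       ≡⟨ cong (_+ q) (trans (+-assoc p F₀ T₁) (+-comm p (F₀ + T₁))) ⟩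
  F₀ + T₁ + p + q       ≡⟨ +-comm (F₀ + T₁ + p) q ⟩
  q + (F₀ + T₁ + p)     ≡⟨ cong (q +_) (occ-∷-split w x) ⟩
  q + occ w x         ∎
  where
  open ≡-Reasoning
  p = bit (isPrefix w x)
  q = bit (isPrefix w (false ∷ x))
  F₀ = occ (false ∷ w) x
  T₁ = occ (true ∷ w) x

occ-∷ : ∀ a w x → occ (a ∷ w) x ≤ occ w x
occ-∷ true w x = ≤-trans (≤-trans (m≤n+m _ (occ (false ∷ w) x)) (m≤m+n _ _)) (≤-reflexive (occ-∷-split w x))
occ-∷ false w x = ≤-trans (≤-trans (m≤m+n _ (occ (true ∷ w) x)) (m≤m+n _ _)) (≤-reflexive (occ-∷-split w x))

isPrefix-snoc-split : ∀ w x →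
  bit (isPrefix (w ++ [ false ]) x) + bit (isPrefix (w ++ [ true ]) x) ≤ bit (isPrefix w x)
isPrefix-snoc-split []          []          = z≤n
isPrefix-snoc-split []          (true ∷ x)  = ≤-refl
isPrefix-snoc-split []          (false ∷ x) = ≤-refl
isPrefix-snoc-split (a ∷ w)     []          = z≤n
isPrefix-snoc-split (true ∷ w)  (true ∷ x)  = isPrefix-snoc-split w x
isPrefix-snoc-split (true ∷ w)  (false ∷ x) = z≤n
isPrefix-snoc-split (false ∷ w) (true ∷ x)  = z≤n
isPrefix-snoc-split (false ∷ w) (false ∷ x) = isPrefix-snoc-split w x

+-interchange : ∀ a b c d → (a + b) + (c + d) ≡ (a + c) + (b + d)
+-interchange a b c d = begin
  a + b + (c + d)   ≡⟨ +-assoc a b _ ⟩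
  a + (b + (c + d)) ≡⟨ cong (a +_) (trans (sym (+-assoc b c d)) (cong (_+ d) (+-comm b c))) ⟩
  a + (c + b + d)   ≡⟨ cong (a +_) (+-assoc c b d) ⟩
  a + (c + (b + d)) ≡⟨ sym (+-assoc a c _) ⟩
  a + c + (b + d)   ∎
  where open ≡-Reasoning

occ-snoc-split : ∀ w x → occ (w ++ [ false ]) x + occ (w ++ [ true ]) x ≤ occ w x
occ-snoc-split w []      = isPrefix-snoc-split w []
occ-snoc-split w (a ∷ x) = begin
  (p + F₀) + (q + T₁) ≡⟨ +-interchange p F₀ q T₁ ⟩
  (p + q) + (F₀ + T₁) ≤⟨ +-mono-≤ (isPrefix-snoc-split w (a ∷ x)) (occ-snoc-split w x) ⟩
  occ w (a ∷ x)     ∎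
  where
  open ≤-Reasoning
  p = bit (isPrefix (w ++ [ false ]) (a ∷ x))
  q = bit (isPrefix (w ++ [ true ]) (a ∷ x))
  F₀ = occ (w ++ [ false ]) x
  T₁ = occ (w ++ [ true ]) x

length-snoc : ∀ (w : Str) b → length (w ++ [ b ]) ≡ suc (length w)
length-snoc w b = trans (length-++ w) (+-comm (length w) 1)

-- The occurrence of `w` at the very end has no successor, so it is counted on the right only.
occ-suffix-split : ∀ y w → suc (occ (w ++ [ false ]) (y ++ w) + occ (w ++ [ true ]) (y ++ w)) ≤ occ w (y ++ w)
occ-suffix-split [] w
  rewrite occ-long (w ++ [ false ]) w (≤-reflexive (sym (length-snoc w false)))
        | occ-long (w ++ [ true ]) w (≤-reflexive (sym (length-snoc w true)))
  = subst (λ z → 1 ≤ occ w z) (++-identityʳ w) (occ-factor [] w [])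
occ-suffix-split (a ∷ y) w = begin
  suc ((p + F₀) + (q + T₁)) ≡⟨ cong suc (+-interchange p F₀ q T₁) ⟩
  suc ((p + q) + (F₀ + T₁)) ≡⟨ sym (+-suc (p + q) (F₀ + T₁)) ⟩
  (p + q) + suc (F₀ + T₁)   ≤⟨ +-mono-≤ (isPrefix-snoc-split w (a ∷ y ++ w)) (occ-suffix-split y w) ⟩
  occ w (a ∷ y ++ w)      ∎
  where
  open ≤-Reasoning
  p = bit (isPrefix (w ++ [ false ]) (a ∷ y ++ w))
  q = bit (isPrefix (w ++ [ true ]) (a ∷ y ++ w))
  F₀ = occ (w ++ [ false ]) (y ++ w)
  T₁ = occ (w ++ [ true ]) (y ++ w)

occ-append : ∀ y e b → suc (occ (e ++ [ b ]) (y ++ e)) ≤ occ (e ++ [ b ]) (y ++ e ++ [ b ])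
occ-append [] e b
  rewrite occ-long (e ++ [ b ]) e (≤-reflexive (sym (length-snoc e b)))
  = subst (λ z → 1 ≤ occ (e ++ [ b ]) z) (++-identityʳ (e ++ [ b ])) (occ-factor [] (e ++ [ b ]) [])
occ-append (a ∷ y) e b = begin
  suc (bit (isPrefix W (a ∷ y ++ e)) + occ W (y ++ e))  ≡⟨ sym (+-suc (bit (isPrefix W (a ∷ y ++ e))) _) ⟩
  bit (isPrefix W (a ∷ y ++ e)) + suc (occ W (y ++ e))  ≤⟨ +-mono-≤ ext (occ-append y e b) ⟩
  occ W (a ∷ y ++ e ++ [ b ])                          ∎
  where
  open ≤-Reasoning
  W = e ++ [ b ]
  ext : bit (isPrefix W (a ∷ y ++ e)) ≤ bit (isPrefix W (a ∷ y ++ e ++ [ b ]))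
  ext = bit-mono λ p → subst (λ z → isPrefix W z ≡ true) (cong (a ∷_) (++-assoc y e [ b ]))
                         (isPrefix-extend W (a ∷ y ++ e) [ b ] p)

-- A new occurrence must end at the appended bit, and the length of `z` makes it start exactly where
-- `v` does.
occ-append-≤ : ∀ z y v b → length z ≡ suc (length v) →
  occ z (y ++ v ++ [ b ]) ≤ occ z (y ++ v) + bit (isPrefix z (v ++ [ b ]))
occ-append-≤ z [] v b l = go v l
  where
  go : ∀ u → length z ≡ suc (length u) → occ z (u ++ [ b ]) ≤ occ z u + bit (isPrefix z (u ++ [ b ]))
  go [] l
    rewrite isPrefix-long z [] (≤-reflexive (sym l)) = ≤-reflexive (+-identityʳ _)
  go (a ∷ u) l
    rewrite occ-long z (u ++ [ b ]) (≤-reflexive (trans (cong suc (length-snoc u b)) (sym l)))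
          | +-identityʳ (bit (isPrefix z (a ∷ u ++ [ b ]))) = m≤n+m _ _
occ-append-≤ z (a ∷ y) v b l = begin
  bit (isPrefix z (a ∷ y ++ v ++ [ b ])) + occ z (y ++ v ++ [ b ])
    ≡⟨ cong (λ u → bit (isPrefix z (a ∷ u)) + occ z (y ++ v ++ [ b ])) (sym (++-assoc y v [ b ])) ⟩
  bit (isPrefix z ((a ∷ y ++ v) ++ [ b ])) + occ z (y ++ v ++ [ b ])
    ≡⟨ cong (λ c → bit c + occ z (y ++ v ++ [ b ])) (isPrefix-++-short z (a ∷ y ++ v) [ b ] short) ⟩
  bit (isPrefix z (a ∷ y ++ v)) + occ z (y ++ v ++ [ b ])
    ≤⟨ +-monoʳ-≤ _ (occ-append-≤ z y v b l) ⟩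
  bit (isPrefix z (a ∷ y ++ v)) + (occ z (y ++ v) + bit (isPrefix z (v ++ [ b ])))
    ≡⟨ sym (+-assoc (bit (isPrefix z (a ∷ y ++ v))) _ _) ⟩
  occ z (a ∷ y ++ v) + bit (isPrefix z (v ++ [ b ])) ∎
  where
  open ≤-Reasoning
  short : length z ≤ length (a ∷ y ++ v)
  short rewrite l | length-++ y {v} = s≤s (m≤n+m _ _)

-- The greedy de Bruijn string

Unique : ℕ → Str → Set
Unique n x = ∀ z → length z ≡ n → occ z x ≤ 1

take-length-++ : ∀ (u v : Str) → take (length u) (u ++ v) ≡ u
take-length-++ []      v = refl
take-length-++ (a ∷ u) v = cong (a ∷_) (take-length-++ u v)

drop-length-++ : ∀ (u v : Str) → drop (length u) (u ++ v) ≡ v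
drop-length-++ []      v = refl
drop-length-++ (a ∷ u) v = drop-length-++ u v

true≢false : ∀ {b} → b ≡ true → b ≡ false → ⊥
true≢false refl ()

T⇒≡ : ∀ {b} → T b → b ≡ true
T⇒≡ {true} _ = refl

≡⇒T : ∀ {b} → b ≡ true → T b
≡⇒T refl = _

allL-complete : ∀ p (f : ℕ → ℕ) n → (∀ i → i < n → p (f i) ≡ true) → allL p (applyUpTo f n) ≡ true
allL-complete p f zero    h = refl
allL-complete p f (suc n) h rewrite h 0 z<s = allL-complete p (f ∘ suc) n λ i i<n → h (suc i) (s<s i<n)

allL-sound : ∀ p (f : ℕ → ℕ) n → allL p (applyUpTo f n) ≡ true → ∀ i → i < n → p (f i) ≡ true
allL-sound p f (suc n) h i i<n with p (f 0) in eq
allL-sound p f (suc n) h zero    _         | true = eq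
allL-sound p f (suc n) h (suc i) (s<s i<n) | true = allL-sound p (f ∘ suc) n h i i<n

uniqueWindows-complete : ∀ n y → Unique n y → uniqueWindows n y ≡ true
uniqueWindows-complete n y uq with length y <ᵇ n in eq
... | true  = refl
... | false = allL-complete _ (λ i → i) _ once
  where
  n≤len : n ≤ length y
  n≤len = ≮⇒≥ λ lt → true≢false (T⇒≡ (<⇒<ᵇ lt)) eq
  once : ∀ i → i < suc (length y ∸ n) → (occ (take n (drop i y)) y ≡ᵇ 1) ≡ true
  once i (s≤s i≤) = T⇒≡ (≡⇒≡ᵇ _ 1 (≤-antisym (uq w len-w) w-occurs))
    where
    w = take n (drop i y)
    len-w : length w ≡ n
    len-w rewrite length-take n (drop i y) | length-drop i y =
      m≤n⇒m⊓n≡m (≤-trans (≤-reflexive (sym (m∸[m∸n]≡n n≤len))) (∸-monoʳ-≤ (length y) i≤))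
    w-occurs : 1 ≤ occ w y
    w-occurs = subst (λ s → 1 ≤ occ w s)
      (trans (cong (take i y ++_) (take++drop≡id n (drop i y))) (take++drop≡id i y))
      (occ-factor (take i y) w (drop n (drop i y)))

uniqueWindows-sound : ∀ n y → uniqueWindows n y ≡ true → Unique n y
uniqueWindows-sound n y h z refl with occ z y in eqo
... | zero  = z≤n
... | suc c with α , β , refl ← occ⇒factor z y (subst (1 ≤_) (sym eqo) (s≤s z≤n))
            with length (α ++ z ++ β) <ᵇ length z in eql
...   | true  = ⊥-elim (<⇒≱ (<ᵇ⇒< _ _ (≡⇒T eql)) len)
  where
  len : length z ≤ length (α ++ z ++ β)
  len rewrite length-++ α {z ++ β} | length-++ z {β} = ≤-trans (m≤m+n _ _) (m≤n+m _ (length α))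
...   | false = ≤-reflexive (trans (sym eqo) once)
  where
  i≤ : length α < suc (length (α ++ z ++ β) ∸ length z)
  i≤ rewrite length-++ α {z ++ β} | length-++ z {β}
           | +-∸-assoc (length α) {length z + length β} (m≤m+n (length z) (length β)) = s≤s (m≤m+n _ _)
  window : take (length z) (drop (length α) (α ++ z ++ β)) ≡ z
  window rewrite drop-length-++ α (z ++ β) = take-length-++ z β
  once : occ z (α ++ z ++ β) ≡ 1
  once = subst (λ w → occ w (α ++ z ++ β) ≡ 1) window
           (≡ᵇ⇒≡ _ 1 (≡⇒T (allL-sound _ (λ i → i) _ h (length α) i≤)))

split-end : ∀ N (x : Str) → N ≤ length x → ∃₂ λ u v → x ≡ u ++ v × length v ≡ N
split-end N x N≤ = take k x , drop k x , sym (take++drop≡id k x) ,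
                   trans (length-drop k x) (m∸[m∸n]≡n N≤)
  where k = length x ∸ N

-- The last component is the trace of the preference for 0: a 1 is appended only after the 0 was refused.
Greedy : ℕ → Str → Set
Greedy N x = (∃ λ y → x ≡ replicate N true ++ y) × Unique (suc N) x ×
             (∀ v → length v ≡ N → 1 ≤ occ (v ++ [ true ]) x → 1 ≤ occ (v ++ [ false ]) x)

-- Being unable to append is recorded through its cause, supplied by `refused⇒occurs`: both
-- extensions of the last `N` bits are already present.
Stuck : ℕ → Str → Set
Stuck N x = ∀ u v → x ≡ u ++ v → length v ≡ N → ∀ b → 1 ≤ occ (v ++ [ b ]) x

length-Greedy : ∀ {N x} → Greedy N x → N ≤ length x
length-Greedy {N} ((y , refl) , _) rewrite length-++ (replicate N true) {y} | length-replicate N {true} = m≤m+n N _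

-- The only new window is `v ++ [ b ]`; were it absent before, uniqueness would survive the step and
-- `b` would not be refused.
refused⇒occurs : ∀ N u v b → Unique (suc N) (u ++ v) → length v ≡ N →
  uniqueWindows (suc N) ((u ++ v) ++ [ b ]) ≡ false → 1 ≤ occ (v ++ [ b ]) (u ++ v)
refused⇒occurs N u v b uq len refused with occ (v ++ [ b ]) (u ++ v) in eq
... | suc _ = s≤s z≤n
... | zero  = ⊥-elim (true≢false (uniqueWindows-complete (suc N) ((u ++ v) ++ [ b ]) uq′) refused)
  where
  uq′ : Unique (suc N) ((u ++ v) ++ [ b ])
  uq′ z lz rewrite ++-assoc u v [ b ] with isPrefix z (v ++ [ b ]) in eqp | occ-append-≤ z u v b (trans lz (cong suc (sym len)))
  ... | false | le rewrite +-identityʳ (occ z (u ++ v)) = ≤-trans le (uq z lz)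
  ... | true  | le with refl ← isPrefix-same-length z (v ++ [ b ]) (trans lz (trans (cong suc (sym len)) (sym (length-snoc v b)))) eqp
                   rewrite eq = le

snoc-bit≢ : ∀ (v w : Str) → length v ≡ length w → isPrefix (v ++ [ true ]) (w ++ [ false ]) ≡ false
snoc-bit≢ []          []          _ = refl
snoc-bit≢ (true ∷ v)  (true ∷ w)  p = snoc-bit≢ v w (suc-injective p)
snoc-bit≢ (true ∷ v)  (false ∷ w) p = refl
snoc-bit≢ (false ∷ v) (true ∷ w)  p = refl
snoc-bit≢ (false ∷ v) (false ∷ w) p = snoc-bit≢ v w (suc-injective p)

Greedy-snoc : ∀ N x b → Greedy N x → uniqueWindows (suc N) (x ++ [ b ]) ≡ true →
  (b ≡ true → uniqueWindows (suc N) (x ++ [ false ]) ≡ false) → Greedy N (x ++ [ b ])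
Greedy-snoc N x b g@((y , x≡) , uq , zf) ok pref =
  (y ++ [ b ] , trans (cong (_++ [ b ]) x≡) (++-assoc (replicate N true) y [ b ])) ,
  uniqueWindows-sound (suc N) (x ++ [ b ]) ok , zf′
  where
  zf′ : ∀ v → length v ≡ N → 1 ≤ occ (v ++ [ true ]) (x ++ [ b ]) → 1 ≤ occ (v ++ [ false ]) (x ++ [ b ])
  zf′ v lv h with u , w , refl , lw ← split-end N x (length-Greedy g) = ≤-trans (go b pref h) (occ-≤-++ʳ _ (u ++ w) [ b ])
    where
    upper : ∀ c → occ (v ++ [ true ]) ((u ++ w) ++ [ c ]) ≤
            occ (v ++ [ true ]) (u ++ w) + bit (isPrefix (v ++ [ true ]) (w ++ [ c ]))
    upper c rewrite ++-assoc u w [ c ] =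
      occ-append-≤ (v ++ [ true ]) u w c (trans (length-snoc v true) (cong suc (trans lv (sym lw))))
    go : ∀ c → (c ≡ true → uniqueWindows (suc N) ((u ++ w) ++ [ false ]) ≡ false) →
         1 ≤ occ (v ++ [ true ]) ((u ++ w) ++ [ c ]) → 1 ≤ occ (v ++ [ false ]) (u ++ w)
    go false pref h with upper false
    ... | le rewrite snoc-bit≢ v w (trans lv (sym lw)) | +-identityʳ (occ (v ++ [ true ]) (u ++ w)) = zf v lv (≤-trans h le)
    go true pref h with isPrefix (v ++ [ true ]) (w ++ [ true ]) in eqp | upper true
    ... | false | le rewrite +-identityʳ (occ (v ++ [ true ]) (u ++ w)) = zf v lv (≤-trans h le)
    ... | true  | le with refl ← ++-cancelʳ _ v w (isPrefix-same-length (v ++ [ true ]) (w ++ [ true ])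
                           (trans (length-snoc v true) (trans (cong suc (trans lv (sym lw))) (sym (length-snoc w true)))) eqp)
      = refused⇒occurs N u v false uq lv (pref refl)

step-cases : ∀ N x → Greedy N x →
  (step (suc N) x ≡ nothing × Stuck N x) ⊎ (∃ λ b → step (suc N) x ≡ just (x ++ [ b ]) × Greedy N (x ++ [ b ]))
step-cases N x g with uniqueWindows (suc N) (x ++ [ false ]) in eq0
... | true  = inj₂ (false , refl , Greedy-snoc N x false g eq0 λ ())
... | false with uniqueWindows (suc N) (x ++ [ true ]) in eq1
...   | true  = inj₂ (true , refl , Greedy-snoc N x true g eq1 λ _ → eq0)
...   | false = inj₁ (refl , stuck)
  where
  stuck : Stuck N x
  stuck u v refl lv true  = refused⇒occurs N u v true (proj₁ (proj₂ g)) lv eq1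
  stuck u v refl lv false = refused⇒occurs N u v false (proj₁ (proj₂ g)) lv eq0

-- The fuel may run out before the construction is blocked. In that case the length is known
-- exactly, and counting replaces the argument for blocked strings.
build-Greedy : ∀ N f x → Greedy N x → let x′ = build (suc N) f x in
  Greedy N x′ × length x′ ≤ length x + f × (length x′ ≡ length x + f ⊎ Stuck N x′)
build-Greedy N zero    x g = g , m≤m+n _ _ , inj₁ (sym (+-identityʳ _))
build-Greedy N (suc f) x g with step-cases N x g
... | inj₁ (eq , st) rewrite eq = g , m≤m+n _ _ , inj₂ st
... | inj₂ (b , eq , g′) rewrite eq
    with build-Greedy N f (x ++ [ b ]) g′
...   | r rewrite length-snoc x b | +-suc (length x) f = r

Greedy-start : ∀ N → Greedy N (replicate N true)
Greedy-start N = ([] , sym (++-identityʳ _)) , (λ z lz → ≤-trans (≤-reflexive (none z lz)) z≤n) ,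
  λ v lv h → ⊥-elim (1+n≰n (≤-trans h (≤-reflexive (none (v ++ [ true ]) (trans (length-snoc v true) (cong suc lv))))))
  where
  none : ∀ z → length z ≡ suc N → occ z (replicate N true) ≡ 0
  none z lz = occ-long z (replicate N true) (≤-reflexive (trans (cong suc (length-replicate N)) (sym lz)))

replicate-snoc : ∀ n (b : Bool) → replicate n b ++ [ b ] ≡ b ∷ replicate n b
replicate-snoc zero    b = refl
replicate-snoc (suc n) b = cong (b ∷_) (replicate-snoc n b)

unsnoc : ∀ {n} (z : Str) → length z ≡ suc n → ∃₂ λ u b → z ≡ u ++ [ b ]
unsnoc (a ∷ [])     _ = [] , a , refl
unsnoc {suc n} (a ∷ c ∷ z) l with u , b , e ← unsnoc (c ∷ z) (suc-injective l) = a ∷ u , b , cong (a ∷_) e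

-- Blocked greedy strings contain every window

module _ {N x} (g : Greedy N x) (stuck : Stuck N x) where
  private
    ones = replicate N true
    tail = proj₁ (proj₁ g)
    x≡   = proj₂ (proj₁ g)
    uq   = proj₁ (proj₂ g)
    zf   = proj₂ (proj₂ g)

    prefix⇒ones : ∀ v → length v ≡ N → isPrefix v x ≡ true → v ≡ ones
    prefix⇒ones v lv p = isPrefix-same-length v ones (trans lv (sym (length-replicate N)))
      (trans (sym (isPrefix-++-short v ones tail (≤-reflexive (trans lv (sym (length-replicate N))))))
             (trans (cong (isPrefix v) (sym x≡)) p))

  -- The last N bits occur three times, twice followed by a bit. At most two occurrences
  -- have a predecessor, so the third one is at the start of x.
  stuck-ends-in-ones : ∃ λ u → x ≡ u ++ ones
  stuck-ends-in-ones with u , v , xuv , lv ← split-end N x (length-Greedy g) with isPrefix v x in eqp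
  ... | true  = u , trans xuv (cong (u ++_) (prefix⇒ones v lv eqp))
  ... | false = ⊥-elim (<⇒≱ three two)
    where
    three : 3 ≤ occ v x
    three = ≤-trans (s≤s (+-mono-≤ (stuck u v xuv lv false) (stuck u v xuv lv true)))
                    (subst (λ s → suc (occ (v ++ [ false ]) s + occ (v ++ [ true ]) s) ≤ occ v s) (sym xuv) (occ-suffix-split u v))
    two : occ v x ≤ 2
    two = subst (_≤ 2) (occ-∷-split v x)
            (≤-trans (≤-reflexive (trans (cong (λ c → occ (false ∷ v) x + occ (true ∷ v) x + bit c) eqp) (+-identityʳ _)))
                     (+-mono-≤ (uq (false ∷ v) (cong suc lv)) (uq (true ∷ v) (cong suc lv))))

  -- Read `x` as a walk whose vertices are its substrings of length `N`: it starts and ends at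
  -- `1^N`, so it is closed and no vertex is left more often than it is entered.
  balance : ∀ v → length v ≡ N →
    occ (v ++ [ false ]) x + occ (v ++ [ true ]) x ≤ occ (false ∷ v) x + occ (true ∷ v) x
  balance v lv with isPrefix v x in eqp
  ... | false = ≤-trans (occ-snoc-split v x)
      (≤-reflexive (trans (sym (occ-∷-split v x))
        (trans (cong (λ c → occ (false ∷ v) x + occ (true ∷ v) x + bit c) eqp) (+-identityʳ _))))
  -- Here `v` is `ones`: the occurrence at the start has no predecessor, the one at the end has no
  -- successor, and the two cancel.
  ... | true with u , xu ← stuck-ends-in-ones = s≤s⁻¹ (≤-trans
      (subst (λ s → suc (occ (v ++ [ false ]) s + occ (v ++ [ true ]) s) ≤ occ v s) (sym xuv) (occ-suffix-split u v))
      (≤-reflexive (trans (sym (occ-∷-split v x))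
        (trans (cong (λ c → occ (false ∷ v) x + occ (true ∷ v) x + bit c) eqp) (+-comm _ 1)))))
    where
    xuv : x ≡ u ++ v
    xuv = trans xu (cong (u ++_) (sym (prefix⇒ones v lv eqp)))

  -- An edge v1 that is missing leaves, by balance and the preference for 0, the edge
  -- ending in 1 missing at the next vertex too; iterating leads to the vertex 1^N.
  missing-propagates : ∀ u i → length u + i ≡ N →
    occ (u ++ replicate i true ++ [ true ]) x ≡ 0 → occ (ones ++ [ true ]) x ≡ 0
  missing-propagates []      i refl h = h
  missing-propagates (a ∷ u) i len h = missing-propagates u (suc i) (trans (+-suc (length u) i) len)
    (subst (λ s → occ s x ≡ 0) (++-assoc u _ _) next)
    where
    v = u ++ true ∷ replicate i true
    lv : length v ≡ N
    lv = trans (length-++ u) (trans (cong (λ k → length u + suc k) (length-replicate i)) (trans (+-suc (length u) i) len))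
    missing : occ (a ∷ v) x ≡ 0
    missing = subst (λ s → occ (a ∷ u ++ s) x ≡ 0) (replicate-snoc i true) h
    ≤one : ∀ c → occ (c ∷ v) x ≡ 0 → occ (false ∷ v) x + occ (true ∷ v) x ≤ 1
    ≤one false e rewrite e = uq (true ∷ v) (cong suc lv)
    ≤one true  e rewrite e | +-identityʳ (occ (false ∷ v) x) = uq (false ∷ v) (cong suc lv)
    next : occ (v ++ [ true ]) x ≡ 0
    next with occ (v ++ [ true ]) x in eq
    ... | zero  = refl
    -- If `v` followed by 1 occurs, so does `v` followed by 0, and `balance` demands two incoming
    -- edges; but one is missing and the other occurs at most once.
    ... | suc c = ⊥-elim (<⇒≱ two≤ (≤one a missing))
      where
      two≤ : 2 ≤ occ (false ∷ v) x + occ (true ∷ v) x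
      two≤ = ≤-trans (+-mono-≤ (zf v lv (subst (1 ≤_) (sym eq) (s≤s z≤n))) (subst (1 ≤_) (sym eq) (s≤s z≤n))) (balance v lv)

  -- A missing window ending in 1 would propagate to `1^N` followed by 1, which is present because
  -- the walk is blocked at `1^N`. Windows ending in 0 follow from those ending in 1 by the
  -- preference for 0.
  stuck-complete : ∀ z → length z ≡ suc N → 1 ≤ occ z x
  stuck-complete z lz with u , b , refl ← unsnoc z lz = go b
    where
    lu : length u ≡ N
    lu = suc-injective (trans (sym (length-snoc u b)) lz)
    go-true : 1 ≤ occ (u ++ [ true ]) x
    go-true with occ (u ++ [ true ]) x in eq
    ... | suc c = s≤s z≤n
    ... | zero with w , xw ← stuck-ends-in-ones =
      ⊥-elim (1+n≰n (≤-trans (stuck w ones xw (length-replicate N) true)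
        (≤-reflexive (missing-propagates u 0 (trans (+-identityʳ _) lu) eq))))
    go : ∀ b → 1 ≤ occ (u ++ [ b ]) x
    go true  = go-true
    go false = zf u lu go-true

-- Counting over all strings of a fixed length

sumAll : ℕ → (Str → ℕ) → ℕ
sumAll zero    h = h []
sumAll (suc n) h = sumAll n (λ z → h (false ∷ z)) + sumAll n (λ z → h (true ∷ z))

sumAll-+ : ∀ n h h′ → sumAll n (λ z → h z + h′ z) ≡ sumAll n h + sumAll n h′
sumAll-+ zero    h h′ = refl
sumAll-+ (suc n) h h′ = trans (cong₂ _+_ (sumAll-+ n _ _) (sumAll-+ n _ _)) (+-interchange (sumAll n (λ z → h (false ∷ z))) _ _ _)

sumAll-0 : ∀ n → sumAll n (λ _ → 0) ≡ 0
sumAll-0 zero    = refl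
sumAll-0 (suc n) = cong₂ _+_ (sumAll-0 n) (sumAll-0 n)

double : ∀ n → n + n ≡ 2 * n
double n = cong (n +_) (sym (+-identityʳ n))

sumAll-≤ : ∀ n h → (∀ z → length z ≡ n → h z ≤ 1) → sumAll n h ≤ 2 ^ n
sumAll-≤ zero    h b = b [] refl
sumAll-≤ (suc n) h b = ≤-trans (+-mono-≤ (sumAll-≤ n _ λ z l → b _ (cong suc l)) (sumAll-≤ n _ λ z l → b _ (cong suc l)))
                               (≤-reflexive (double (2 ^ n)))

sumAll-≥ : ∀ n h → (∀ z → length z ≡ n → 1 ≤ h z) → 2 ^ n ≤ sumAll n h
sumAll-≥ zero    h b = b [] refl
sumAll-≥ (suc n) h b = ≤-trans (≤-reflexive (sym (double (2 ^ n))))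
  (+-mono-≤ (sumAll-≥ n _ λ z l → b _ (cong suc l)) (sumAll-≥ n _ λ z l → b _ (cong suc l)))

sumAll-full : ∀ n h → (∀ z → length z ≡ n → h z ≤ 1) → 2 ^ n ≤ sumAll n h → ∀ z → length z ≡ n → 1 ≤ h z
sumAll-full zero    h b full []      l = full
sumAll-full (suc n) h b full (false ∷ z) l = sumAll-full n _ (λ z l → b _ (cong suc l))
  (+-cancelʳ-≤ (2 ^ n) _ _ (≤-trans (≤-reflexive (double (2 ^ n))) (≤-trans full (+-monoʳ-≤ _ (sumAll-≤ n _ λ z l → b _ (cong suc l))))))
  z (suc-injective l)
sumAll-full (suc n) h b full (true ∷ z) l = sumAll-full n _ (λ z l → b _ (cong suc l))
  (+-cancelˡ-≤ (2 ^ n) _ _ (≤-trans (≤-reflexive (double (2 ^ n))) (≤-trans full (+-monoˡ-≤ _ (sumAll-≤ n _ λ z l → b _ (cong suc l))))))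
  z (suc-injective l)

sumAll-isPrefix : ∀ n x → n ≤ length x → sumAll n (λ z → bit (isPrefix z x)) ≡ 1
sumAll-isPrefix zero    x           _       = refl
sumAll-isPrefix (suc n) (false ∷ x) (s≤s p) = cong₂ _+_ (sumAll-isPrefix n x p) (sumAll-0 n)
sumAll-isPrefix (suc n) (true ∷ x)  (s≤s p) = cong₂ _+_ (sumAll-0 n) (sumAll-isPrefix n x p)

sumAll-zero : ∀ n h → (∀ z → length z ≡ n → h z ≡ 0) → sumAll n h ≡ 0
sumAll-zero zero    h e = e [] refl
sumAll-zero (suc n) h e = cong₂ _+_ (sumAll-zero n _ λ z l → e _ (cong suc l)) (sumAll-zero n _ λ z l → e _ (cong suc l))

-- Each position of `x` with at least `n` bits after it starts exactly one string of length `n`;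
-- adding `n` on the left avoids a truncated subtraction.
sumAll-occ : ∀ n x → n ≤ suc (length x) → sumAll n (λ z → occ z x) + n ≡ suc (length x)
sumAll-occ n x p with m≤n⇒m<n∨m≡n p
sumAll-occ n x p | inj₂ refl =
  cong (_+ n) (sumAll-zero n (λ z → occ z x) λ z l → occ-long z x (≤-reflexive (sym l)))
sumAll-occ zero [] p    | inj₁ _ = refl
sumAll-occ (suc n) [] p | inj₁ (s≤s ())
sumAll-occ n (a ∷ x) p  | inj₁ (s≤s q) =
  trans (cong (_+ n) (sumAll-+ n (λ z → bit (isPrefix z (a ∷ x))) (λ z → occ z x)))
  (trans (cong (λ k → k + sumAll n (λ z → occ z x) + n) (sumAll-isPrefix n (a ∷ x) q)) (cong suc (sumAll-occ n x q)))

module _ (N : ℕ) where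
  private
    start = replicate N true
    x     = build (suc N) (2 ^ suc N) start
    d     = db (suc N)
    built = build-Greedy N (2 ^ suc N) start (Greedy-start N)
    g     = proj₁ built
    uq    = proj₁ (proj₂ g)

    x≡ : x ≡ start ++ d
    x≡ with y , e ← proj₁ g = trans e (cong (start ++_) (sym (trans (cong (drop N) e)
           (trans (cong (λ k → drop k (start ++ y)) (sym (length-replicate N))) (drop-length-++ start y)))))

    length-x : length x ≡ N + length d
    length-x = trans (cong length x≡) (trans (length-++ start) (cong (_+ length d) (length-replicate N)))

    windows : sumAll (suc N) (λ z → occ z x) ≡ length d
    windows = +-cancelʳ-≡ (suc N) _ _ (trans (sumAll-occ (suc N) x (s≤s (≤-trans (m≤m+n N _) (≤-reflexive (sym length-x)))))
      (trans (cong suc length-x) (trans (cong suc (+-comm N _)) (sym (+-suc (length d) N)))))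

    complete : ∀ z → length z ≡ suc N → 1 ≤ occ z x
    complete with proj₂ (proj₂ built)
    ... | inj₂ stuck = stuck-complete g stuck
    -- With the fuel used up, `2 ^ suc N` windows have been placed without repetition, so none is
    -- left out.
    ... | inj₁ full  = sumAll-full (suc N) _ uq (≤-reflexive (sym (trans windows
        (+-cancelˡ-≡ N _ _ (trans (sym length-x) (trans full (cong (_+ 2 ^ suc N) (length-replicate N))))))))

    occ-after-ones : ∀ z i y → occ (false ∷ z) (replicate i true ++ y) ≡ occ (false ∷ z) y
    occ-after-ones z zero    y = refl
    occ-after-ones z (suc i) y = occ-after-ones z i y

  db-unique : Unique (suc N) d
  db-unique z lz = ≤-trans (≤-trans (occ-≤-++ˡ z start d) (≤-reflexive (cong (occ z) (sym x≡)))) (uq z lz)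

  length-db : length d ≡ 2 ^ suc N
  length-db = ≤-antisym
    (+-cancelˡ-≤ N _ _ (≤-trans (≤-reflexive (sym length-x))
      (≤-trans (proj₁ (proj₂ built)) (≤-reflexive (cong (_+ 2 ^ suc N) (length-replicate N))))))
    (≤-trans (sumAll-≥ (suc N) _ complete) (≤-reflexive windows))

  -- Deleting the prefix `1^N` loses the windows that start in it. The window `false ∷ z` cannot
  -- start there, so it survives, and `z` with it.
  db-contains : ∀ z → length z ≡ N → 1 ≤ occ z d
  db-contains z lz = ≤-trans (complete (false ∷ z) (cong suc lz))
    (≤-trans (≤-reflexive (trans (cong (occ (false ∷ z)) x≡) (occ-after-ones z N d))) (occ-∷ false z d))

-- One step of PPM*

∧-true : ∀ {a b} → (a ∧ b) ≡ true → a ≡ true × b ≡ true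
∧-true {true} {true} _ = refl , refl

firstWhere-just : ∀ p f n {j} → firstWhere p (applyUpTo f n) ≡ just j →
  ∃ λ i → i < n × j ≡ f i × p j ≡ true × (∀ i′ → i′ < i → p (f i′) ≡ false)
firstWhere-just p f (suc n) eq with p (f 0) in eqp
firstWhere-just p f (suc n) refl | true = 0 , z<s , refl , eqp , λ _ ()
firstWhere-just p f (suc n) eq   | false with i , i<n , je , pj , before ← firstWhere-just p (f ∘ suc) n eq =
  suc i , s<s i<n , je , pj , λ { zero _ → eqp ; (suc i′) (s<s l) → before i′ l }

firstWhere-nothing : ∀ p f n → firstWhere p (applyUpTo f n) ≡ nothing → ∀ i → i < n → p (f i) ≡ false
firstWhere-nothing p f (suc n) eq i i<n with p (f 0) in eqp
firstWhere-nothing p f (suc n) eq zero    _         | false = eqp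
firstWhere-nothing p f (suc n) eq (suc i) (s<s i<n) | false = firstWhere-nothing p (f ∘ suc) n eq i i<n

firstWhere-downFrom-just : ∀ p n {j} → firstWhere p (downFrom n) ≡ just j →
  j < n × p j ≡ true × (∀ i → j < i → i < n → p i ≡ false)
firstWhere-downFrom-just p (suc n) eq with p n in eqp
firstWhere-downFrom-just p (suc n) refl | true = ≤-refl , eqp , λ i j<i i≤j → ⊥-elim (<⇒≱ j<i (s≤s⁻¹ i≤j))
firstWhere-downFrom-just p (suc n) {j} eq | false with j<n , pj , after ← firstWhere-downFrom-just p n eq =
  m≤n⇒m≤1+n j<n , pj , after′
  where
  after′ : ∀ i → j < i → i < suc n → p i ≡ false
  after′ i j<i i≤n with m≤n⇒m<n∨m≡n (s≤s⁻¹ i≤n)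
  ... | inj₁ i<n  = after i j<i i<n
  ... | inj₂ refl = eqp

firstWhere-downFrom-nothing : ∀ p n → firstWhere p (downFrom n) ≡ nothing → ∀ i → i < n → p i ≡ false
firstWhere-downFrom-nothing p (suc n) eq i i≤n with p n in eqp
... | false with m≤n⇒m<n∨m≡n (s≤s⁻¹ i≤n)
...   | inj₁ i<n  = firstWhere-downFrom-nothing p n eq i i<n
...   | inj₂ refl = eqp

dropLast-prefix : ∀ s → ∃ λ u → s ≡ dropLast s ++ u
dropLast-prefix []          = [] , refl
dropLast-prefix (a ∷ [])    = [ a ] , refl
dropLast-prefix (a ∷ b ∷ s) with u , e ← dropLast-prefix (b ∷ s) = u , cong (a ∷_) e

occ-drop : ∀ m u s x → occ (u ++ s) x ≤ occ (drop m u ++ s) x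
occ-drop zero    u       s x = ≤-refl
occ-drop (suc m) []      s x = ≤-refl
occ-drop (suc m) (a ∷ u) s x = ≤-trans (occ-∷ a (u ++ s) x) (occ-drop m u s x)

numEsc : ℕ → ℕ → ℕ
numEsc m n = bit (0 <ᵇ m) + bit (0 <ᵇ n)

numEsc≡1⇒other≡0 : ∀ m n → numEsc m n ≡ 1 → (1 ≤ m → n ≡ 0) × (1 ≤ n → m ≡ 0)
numEsc≡1⇒other≡0 zero    zero    ()
numEsc≡1⇒other≡0 zero    (suc n) _ = (λ ()) , (λ _ → refl)
numEsc≡1⇒other≡0 (suc m) zero    _ = (λ _ → refl) , (λ ())

zero⊎pos : ∀ m → m ≡ 0 ⊎ 1 ≤ m
zero⊎pos zero    = inj₁ refl
zero⊎pos (suc m) = inj₂ (s≤s z≤n)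

module _ (x : Str) where
  open PPM x

  suf-++ : ∀ y e → x ≡ y ++ e → suf (length e) ≡ e
  suf-++ y e refl = trans (cong (λ k → drop k (y ++ e)) (trans (cong (_∸ length e) (length-++ y)) (m+n∸n≡m (length y) (length e))))
                          (drop-length-++ y e)

  cnt-antitone : ∀ {ℓ ℓ′} b → ℓ ≤ ℓ′ → cnt ℓ′ b ≤ cnt ℓ b
  cnt-antitone {ℓ} {ℓ′} b le = subst (λ s → cnt ℓ′ b ≤ occ (s ++ [ b ]) x)
    (trans (drop-drop j k-j x) (cong (λ i → drop i x) (m+[n∸m]≡n (∸-monoʳ-≤ lenx le))))
    (occ-drop k-j (suf ℓ′) [ b ] x)
    where
    j   = lenx ∸ ℓ′
    k-j = (lenx ∸ ℓ) ∸ j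

  counts : ℕ → ℕ
  counts ℓ = cnt ℓ false + cnt ℓ true

  counts-antitone : ∀ {ℓ ℓ′} → ℓ ≤ ℓ′ → counts ℓ′ ≤ counts ℓ
  counts-antitone le = +-mono-≤ (cnt-antitone false le) (cnt-antitone true le)

  cnt≤counts : ∀ ℓ b → cnt ℓ b ≤ counts ℓ
  cnt≤counts ℓ true  = m≤n+m _ _
  cnt≤counts ℓ false = m≤m+n _ _

  esc≤2 : ∀ ℓ → esc ℓ ≤ 2
  esc≤2 ℓ = +-mono-≤ (bit≤1 (0 <ᵇ cnt ℓ false)) (bit≤1 (0 <ᵇ cnt ℓ true))

  -- The occurrence at the end of `x` and one that is followed by a bit are two occurrences of the
  -- context, so the condition of the model on the context without its last bit is automatic.
  counts⇒relevant : ∀ {ℓ} → ℓ ≤ lenx → 1 ≤ counts ℓ → relevant ℓ ≡ true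
  counts⇒relevant {ℓ} ℓ≤ pos rewrite T⇒≡ (≤⇒≤ᵇ ℓ≤) = go ℓ ℓ≤ pos
    where
    somewhere : ∀ m n → 1 ≤ m + n → ((0 <ᵇ m) ∨ (0 <ᵇ n)) ≡ true
    somewhere (suc m) n       _ = refl
    somewhere zero    (suc n) _ = refl
    go : ∀ ℓ → ℓ ≤ lenx → 1 ≤ counts ℓ → isModel ℓ ≡ true
    go zero    _  _   = refl
    go (suc k) ℓ≤ pos rewrite somewhere (cnt (suc k) false) (cnt (suc k) true) pos = T⇒≡ (<⇒<ᵇ twice)
      where
      s = suf (suc k)
      j = lenx ∸ suc k
      twice : 1 < occ (dropLast s) x
      twice with u , e ← dropLast-prefix s = begin-strict
        1                       <⟨ s≤s pos ⟩
        suc (counts (suc k))    ≤⟨ subst (λ z → suc (occ (s ++ [ false ]) z + occ (s ++ [ true ]) z) ≤ occ s z)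
                                     (take++drop≡id j x) (occ-suffix-split (take j x) s) ⟩
        occ s x                 ≡⟨ cong (λ z → occ z x) e ⟩
        occ (dropLast s ++ u) x ≤⟨ occ-shortenʳ (dropLast s) u x ⟩
        occ (dropLast s) x      ∎
        where open ≤-Reasoning

  relevant⇒counts : ∀ ℓ → relevant ℓ ≡ true → ℓ ≤ lenx × (ℓ ≡ 0 ⊎ 1 ≤ counts ℓ)
  relevant⇒counts ℓ r with l , m ← ∧-true {ℓ ≤ᵇ lenx} r = ≤ᵇ⇒≤ ℓ lenx (≡⇒T l) , go ℓ m
    where
    somewhere : ∀ m n → ((0 <ᵇ m) ∨ (0 <ᵇ n)) ≡ true → 1 ≤ m + n
    somewhere (suc m) n       _ = s≤s z≤n
    somewhere zero    (suc n) _ = s≤s z≤n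
    go : ∀ ℓ → isModel ℓ ≡ true → ℓ ≡ 0 ⊎ 1 ≤ counts ℓ
    go zero    _ = inj₁ refl
    go (suc k) m = inj₂ (somewhere (cnt (suc k) false) (cnt (suc k) true) (proj₁ (∧-true m)))

  determined : ℕ → Bool
  determined ℓ = relevant ℓ ∧ deterministic ℓ

  -- Unfolds the choice of the starting context; the fallback 0 never arises, since the empty
  -- context is always relevant.
  start-spec : (determined startLen ≡ true × (∀ j → j < startLen → determined j ≡ false))
             ⊎ ((∀ j → j ≤ lenx → determined j ≡ false) ×
                relevant startLen ≡ true × (∀ j → startLen < j → j ≤ lenx → relevant j ≡ false))
  start-spec with firstWhere determined (upTo (suc lenx)) in eq
  ... | just ℓ with i , _ , refl , p , before ← firstWhere-just determined (λ i → i) (suc lenx) eq = inj₁ (p , before)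
  ... | nothing with firstWhere relevant (reverse (upTo (suc lenx))) in eq′
  ...   | just ℓ with _ , p , after ← firstWhere-downFrom-just relevant (suc lenx)
                        (trans (cong (firstWhere relevant) (sym (reverse-upTo (suc lenx)))) eq′)
          = inj₂ ((λ j j≤ → firstWhere-nothing determined (λ i → i) (suc lenx) eq j (s≤s j≤)) , p , λ j l m → after j l (s≤s m))
  ...   | nothing = ⊥-elim (true≢false {relevant 0} refl (firstWhere-downFrom-nothing relevant (suc lenx)
                        (trans (cong (firstWhere relevant) (sym (reverse-upTo (suc lenx)))) eq′) 0 z<s))

  search-hit : ∀ b ℓ → relevant ℓ ≡ true → 1 ≤ cnt ℓ b → search b ℓ ≡ (cnt ℓ b , total ℓ)
  search-hit b zero    r p rewrite T⇒≡ (<⇒<ᵇ p) = refl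
  search-hit b (suc k) r p rewrite r | T⇒≡ (<⇒<ᵇ p) = refl

  search-escape : ∀ b k → relevant (suc k) ≡ true → cnt (suc k) b ≡ 0 →
    search b (suc k) ≡ escFactor (suc k) ⊗ search b k
  search-escape b k r c rewrite r | c = refl

  escFactor-pos : ∀ ℓ → 1 ≤ proj₁ (escFactor ℓ)
  escFactor-pos ℓ with esc ℓ
  ... | zero  = ≤-refl
  ... | suc _ = s≤s z≤n

  search-pos : ∀ b ℓ → 1 ≤ proj₁ (search b ℓ)
  search-pos b zero with cnt 0 b in eq
  ... | suc c = s≤s z≤n
  ... | zero  = *-mono-≤ (escFactor-pos 0) ≤-refl
  search-pos b (suc k) with relevant (suc k)
  ... | false = search-pos b k
  ... | true with cnt (suc k) b
  ...   | suc c = s≤s z≤n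
  ...   | zero  = *-mono-≤ (escFactor-pos (suc k)) (search-pos b k)

  deterministic-esc : ∀ ℓ → deterministic ℓ ≡ true → esc ℓ ≡ 1
  deterministic-esc ℓ d = ≡ᵇ⇒≡ _ 1 (≡⇒T d)

  total-det : ∀ ℓ b → esc ℓ ≡ 1 → 1 ≤ cnt ℓ b → total ℓ ≡ suc (cnt ℓ b)
  total-det ℓ true e p rewrite e | proj₂ (numEsc≡1⇒other≡0 (cnt ℓ false) (cnt ℓ true) e) p = +-comm _ 1
  total-det ℓ false e p rewrite e | proj₁ (numEsc≡1⇒other≡0 (cnt ℓ false) (cnt ℓ true) e) p
    = trans (+-comm (cnt ℓ false + 0) 1) (cong suc (+-identityʳ _))

  nondet⇒both : ∀ ℓ → ℓ ≤ lenx → 1 ≤ counts ℓ → determined ℓ ≡ false → ∀ b → 1 ≤ cnt ℓ b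
  nondet⇒both ℓ ℓ≤ pos nd rewrite counts⇒relevant ℓ≤ pos = go (cnt ℓ false) (cnt ℓ true) refl refl pos nd
    where
    go : ∀ m n → m ≡ cnt ℓ false → n ≡ cnt ℓ true → 1 ≤ m + n → (numEsc m n ≡ᵇ 1) ≡ false → ∀ b → 1 ≤ cnt ℓ b
    go zero    (suc n) _ _ _ ()
    go (suc m) zero    _ _ _ ()
    go (suc m) (suc n) e _ _ _ false = subst (1 ≤_) e (s≤s z≤n)
    go (suc m) (suc n) _ e _ _ true  = subst (1 ≤_) e (s≤s z≤n)

  both⇒nondet : ∀ ℓ → (∀ b → 1 ≤ cnt ℓ b) → esc ℓ ≢ 1
  both⇒nondet ℓ h e = 1+n≰n (≤-trans (h true) (≤-reflexive (proj₁ (numEsc≡1⇒other≡0 (cnt ℓ false) (cnt ℓ true) e) (h false))))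

  total≤ : ∀ {t ℓ} → t ≤ ℓ → total ℓ ≤ counts t + 2
  total≤ {ℓ = ℓ} le = +-mono-≤ (counts-antitone le) (esc≤2 ℓ)

  -- Contexts of length at most `t` have seen both bits, so a deterministic starting context is
  -- longer than `t`. If it does not predict `b`, the context one bit shorter is not deterministic,
  -- by minimality, and so predicts both bits: one escape suffices. Both denominators are at most
  -- `counts t + 2`, whence the square.
  probBit-branching : ∀ t b → t ≤ lenx → (∀ c → 1 ≤ cnt t c) →
    proj₂ (probBit b) ≤ (counts t + 2) * (counts t + 2)
  probBit-branching t b t≤ both = go startLen start-spec
    where
    Q = counts t + 2

    hit : ∀ ℓ → t ≤ ℓ → relevant ℓ ≡ true → 1 ≤ cnt ℓ b → proj₂ (search b ℓ) ≤ Q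
    hit ℓ le r p = ≤-trans (≤-reflexive (cong proj₂ (search-hit b ℓ r p))) (total≤ le)

    1≤Q : 1 ≤ Q
    1≤Q = ≤-trans (s≤s z≤n) (m≤n+m 2 (counts t))

    Q≤Q*Q : Q ≤ Q * Q
    Q≤Q*Q = ≤-trans (≤-reflexive (sym (*-identityˡ Q))) (*-monoˡ-≤ Q 1≤Q)

    pos-below : ∀ {ℓ} → ℓ ≤ t → 1 ≤ counts ℓ
    pos-below le = ≤-trans (both false) (≤-trans (m≤m+n _ _) (counts-antitone le))

    escFactor≤ : ∀ ℓ → t ≤ ℓ → proj₂ (escFactor ℓ) ≤ Q
    escFactor≤ ℓ le with esc ℓ | total≤ le
    ... | zero  | _ = 1≤Q
    ... | suc e | h = h

    go : ∀ s → (determined s ≡ true × (∀ j → j < s → determined j ≡ false))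
             ⊎ ((∀ j → j ≤ lenx → determined j ≡ false) × relevant s ≡ true × (∀ j → s < j → j ≤ lenx → relevant j ≡ false)) →
         proj₂ (search b s) ≤ Q * Q
    go s (inj₂ (nd , r , after)) = ≤-trans (hit s t≤s r (nondet⇒both s s≤ pos (nd s s≤) b)) Q≤Q*Q
      where
      s≤ = proj₁ (relevant⇒counts s r)
      t≤s : t ≤ s
      t≤s = ≮⇒≥ λ s<t → true≢false (counts⇒relevant t≤ (pos-below ≤-refl)) (after t s<t t≤)
      pos : 1 ≤ counts s
      pos with proj₂ (relevant⇒counts s r)
      ... | inj₁ refl = pos-below z≤n
      ... | inj₂ p    = p
    go s (inj₁ (det , before)) = det-case s refl det before
      where
      esc1 = deterministic-esc s (proj₂ (∧-true {relevant s} det))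
      t<s : t < s
      t<s = ≰⇒> λ s≤t → both⇒nondet s (λ c → ≤-trans (both c) (cnt-antitone c s≤t)) esc1
      det-case : ∀ s′ → s′ ≡ s → determined s′ ≡ true → (∀ j → j < s′ → determined j ≡ false) → proj₂ (search b s′) ≤ Q * Q
      det-case zero    refl _ _ = ⊥-elim (n≮0 t<s)
      det-case (suc k) refl det before with zero⊎pos (cnt (suc k) b)
      ... | inj₂ p  = ≤-trans (hit (suc k) (<⇒≤ t<s) (proj₁ (∧-true {relevant (suc k)} det)) p) Q≤Q*Q
      ... | inj₁ eq = begin
        proj₂ (search b (suc k))                    ≡⟨ cong proj₂ (search-escape b k rel eq) ⟩
        proj₂ (escFactor (suc k)) * proj₂ (search b k) ≤⟨ *-mono-≤ (escFactor≤ (suc k) (<⇒≤ t<s))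
                                                          (hit k (s≤s⁻¹ t<s) (counts⇒relevant k≤ pos)
                                                               (nondet⇒both k k≤ pos (before k ≤-refl) b)) ⟩
        Q * Q                                       ∎
        where
        open ≤-Reasoning
        rel = proj₁ (∧-true {relevant (suc k)} det)
        k≤ : k ≤ lenx
        k≤ = ≤-trans (n≤1+n k) (proj₁ (relevant⇒counts (suc k) rel))
        pos : 1 ≤ counts k
        pos with proj₂ (relevant⇒counts (suc k) rel)
        ... | inj₂ p = ≤-trans p (counts-antitone (n≤1+n k))

  -- The context of length `H` is itself deterministic, so the starting one is not longer. A shorter
  -- context has at least the same counts, so the starting one has seen `b` at least as often and,
  -- being deterministic, nothing else.
  probBit-deterministic : ∀ H b → H ≤ lenx → 1 ≤ cnt H b → cnt H (not b) ≡ 0 →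
    ∃ λ c → cnt H b ≤ c × probBit b ≡ (c , suc c)
  probBit-deterministic H b H≤ p none = go start-spec
    where
    detH : ∀ b → 1 ≤ cnt H b → cnt H (not b) ≡ 0 → deterministic H ≡ true
    detH true  p e rewrite e | T⇒≡ (<⇒<ᵇ p) = refl
    detH false p e rewrite e | T⇒≡ (<⇒<ᵇ p) = refl
    determinedH : determined H ≡ true
    determinedH = cong₂ _∧_ (counts⇒relevant H≤ (≤-trans p (cnt≤counts H b))) (detH b p none)
    go : _ → ∃ λ c → cnt H b ≤ c × probBit b ≡ (c , suc c)
    go (inj₂ (nd , _)) = ⊥-elim (true≢false determinedH (nd H H≤))
    go (inj₁ (det , before)) = cnt startLen b , c≤ ,
      trans (search-hit b startLen rel 1≤c)
            (cong (cnt startLen b ,_) (total-det startLen b (deterministic-esc startLen (proj₂ (∧-true {relevant startLen} det))) 1≤c))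
      where
      rel = proj₁ (∧-true {relevant startLen} det)
      c≤ : cnt H b ≤ cnt startLen b
      c≤ = cnt-antitone b (≮⇒≥ λ lt → true≢false determinedH (before H lt))
      1≤c = ≤-trans p c≤

-- Sums over windows

-- Too short a suffix contributes 0, so `sumWindows` runs over the complete windows of `d`, by
-- position.
atStart : ℕ → (Str → ℕ) → Str → ℕ
atStart ℓ h s = if ℓ ≤ᵇ length s then h (take ℓ s) else 0

sumWindows : ℕ → (Str → ℕ) → Str → ℕ
sumWindows ℓ h []      = 0
sumWindows ℓ h (a ∷ d) = atStart ℓ h (a ∷ d) + sumWindows ℓ h d

take-all-length : ∀ {ℓ} (s : Str) → ℓ ≤ length s → length (take ℓ s) ≡ ℓ
take-all-length {ℓ} s p = trans (length-take ℓ s) (m≤n⇒m⊓n≡m p)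

≤ᵇ-true : ∀ {m n} → m ≤ n → (m ≤ᵇ n) ≡ true
≤ᵇ-true p = T⇒≡ (≤⇒≤ᵇ p)

atStart-mono : ∀ ℓ {h h′} s → (∀ W → length W ≡ ℓ → h W ≤ h′ W) → atStart ℓ h s ≤ atStart ℓ h′ s
atStart-mono ℓ s le with ℓ ≤ᵇ length s in eq
... | false = z≤n
... | true  = le _ (take-all-length s (≤ᵇ⇒≤ ℓ _ (≡⇒T eq)))

sumWindows-mono : ∀ ℓ {h h′} d → (∀ W → length W ≡ ℓ → h W ≤ h′ W) → sumWindows ℓ h d ≤ sumWindows ℓ h′ d
sumWindows-mono ℓ []      le = z≤n
sumWindows-mono ℓ (a ∷ d) le = +-mono-≤ (atStart-mono ℓ (a ∷ d) le) (sumWindows-mono ℓ d le)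

atStart-+ : ∀ ℓ h h′ s → atStart ℓ (λ W → h W + h′ W) s ≡ atStart ℓ h s + atStart ℓ h′ s
atStart-+ ℓ h h′ s with ℓ ≤ᵇ length s
... | false = refl
... | true  = refl

sumWindows-+ : ∀ ℓ h h′ d → sumWindows ℓ (λ W → h W + h′ W) d ≡ sumWindows ℓ h d + sumWindows ℓ h′ d
sumWindows-+ ℓ h h′ []      = refl
sumWindows-+ ℓ h h′ (a ∷ d) =
  trans (cong₂ _+_ (atStart-+ ℓ h h′ (a ∷ d)) (sumWindows-+ ℓ h h′ d))
        (+-interchange (atStart ℓ h (a ∷ d)) _ _ _)

atStart-* : ∀ ℓ c h s → atStart ℓ (λ W → c * h W) s ≡ c * atStart ℓ h s
atStart-* ℓ c h s with ℓ ≤ᵇ length s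
... | false = sym (*-zeroʳ c)
... | true  = refl

sumWindows-* : ∀ ℓ c h d → sumWindows ℓ (λ W → c * h W) d ≡ c * sumWindows ℓ h d
sumWindows-* ℓ c h []      = sym (*-zeroʳ c)
sumWindows-* ℓ c h (a ∷ d) =
  trans (cong₂ _+_ (atStart-* ℓ c h (a ∷ d)) (sumWindows-* ℓ c h d)) (sym (*-distribˡ-+ c (atStart ℓ h (a ∷ d)) _))

sumWindows-const : ∀ ℓ c d → sumWindows ℓ (λ _ → c) d ≤ length d * c
sumWindows-const ℓ c []      = z≤n
sumWindows-const ℓ c (a ∷ d) = +-mono-≤ le (sumWindows-const ℓ c d)
  where
  le : atStart ℓ (λ _ → c) (a ∷ d) ≤ c
  le with ℓ ≤ᵇ length (a ∷ d)
  ... | false = z≤n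
  ... | true  = ≤-refl

take-≤-++ : ∀ ℓ (s β : Str) → ℓ ≤ length s → take ℓ (s ++ β) ≡ take ℓ s
take-≤-++ zero    s       β _       = refl
take-≤-++ (suc ℓ) (a ∷ s) β (s≤s p) = cong (a ∷_) (take-≤-++ ℓ s β p)

atStart-≤-++ : ∀ ℓ h s β → atStart ℓ h s ≤ atStart ℓ h (s ++ β)
atStart-≤-++ ℓ h s β with ℓ ≤ᵇ length s in eq
... | false = z≤n
... | true
  rewrite ≤ᵇ-true {ℓ} {length (s ++ β)} (≤-trans (≤ᵇ⇒≤ ℓ _ (≡⇒T eq)) (≤-trans (m≤m+n _ _) (≤-reflexive (sym (length-++ s)))))
        | take-≤-++ ℓ s β (≤ᵇ⇒≤ ℓ _ (≡⇒T eq)) = ≤-refl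

sumWindows-≤-++ʳ : ∀ ℓ h w β → sumWindows ℓ h w ≤ sumWindows ℓ h (w ++ β)
sumWindows-≤-++ʳ ℓ h []      β = z≤n
sumWindows-≤-++ʳ ℓ h (a ∷ w) β = +-mono-≤ (atStart-≤-++ ℓ h (a ∷ w) β) (sumWindows-≤-++ʳ ℓ h w β)

sumWindows-≤-++ˡ : ∀ ℓ h α w → sumWindows ℓ h w ≤ sumWindows ℓ h (α ++ w)
sumWindows-≤-++ˡ ℓ h []      w = ≤-refl
sumWindows-≤-++ˡ ℓ h (a ∷ α) w = ≤-trans (sumWindows-≤-++ˡ ℓ h α w) (m≤n+m _ _)

-- Lets a visit of a single window raise a potential summed over `d`: the window occurs at some
-- position of `d`, and no other term drops.
sumWindows-increment : ∀ {ℓ} h h′ δ α a w β → length (a ∷ w) ≡ ℓ → (∀ W → h W ≤ h′ W) →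
  h (a ∷ w) + δ ≤ h′ (a ∷ w) → sumWindows ℓ h (α ++ a ∷ w ++ β) + δ ≤ sumWindows ℓ h′ (α ++ a ∷ w ++ β)
sumWindows-increment {ℓ} h h′ δ [] a w β refl le inc
  rewrite ≤ᵇ-true {length (a ∷ w)} {length (a ∷ w ++ β)} (≤-trans (m≤m+n _ _) (≤-reflexive (sym (length-++ (a ∷ w)))))
        | take-length-++ w β = begin
  h W + sumWindows ℓ h (w ++ β) + δ   ≡⟨ +-assoc (h W) _ δ ⟩
  h W + (sumWindows ℓ h (w ++ β) + δ) ≡⟨ cong (h W +_) (+-comm _ δ) ⟩
  h W + (δ + sumWindows ℓ h (w ++ β)) ≡⟨ sym (+-assoc (h W) δ _) ⟩
  h W + δ + sumWindows ℓ h (w ++ β)   ≤⟨ +-mono-≤ inc (sumWindows-mono ℓ (w ++ β) λ V _ → le V) ⟩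
  h′ W + sumWindows ℓ h′ (w ++ β)     ∎
  where
  open ≤-Reasoning
  W = a ∷ w
sumWindows-increment {ℓ} h h′ δ (c ∷ α) a w β l le inc = ≤-trans (≤-reflexive (+-assoc (atStart ℓ h (c ∷ α ++ a ∷ w ++ β)) _ δ))
  (+-mono-≤ (atStart-mono ℓ (c ∷ α ++ a ∷ w ++ β) λ V _ → le V) (sumWindows-increment h h′ δ α a w β l le inc))

sumWindows-pos : ∀ ℓ h d → 1 ≤ sumWindows ℓ h d →
  ∃ λ W → length W ≡ ℓ × 1 ≤ h W × (∃₂ λ α β → d ≡ α ++ W ++ β)
sumWindows-pos ℓ h (a ∷ d) p with ℓ ≤ᵇ length (a ∷ d) in eq | zero⊎pos (h (take ℓ (a ∷ d)))
... | true | inj₂ q = take ℓ (a ∷ d) , take-all-length (a ∷ d) (≤ᵇ⇒≤ ℓ _ (≡⇒T eq)) , q , [] , drop ℓ (a ∷ d) , sym (take++drop≡id ℓ (a ∷ d))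
... | true | inj₁ q with W , l , r , α , β , e ← sumWindows-pos ℓ h d (subst (λ k → 1 ≤ k + sumWindows ℓ h d) q p) =
  W , l , r , a ∷ α , β , cong (a ∷_) e
sumWindows-pos ℓ h (a ∷ d) p | false | _ with W , l , r , α , β , e ← sumWindows-pos ℓ h d p =
  W , l , r , a ∷ α , β , cong (a ∷_) e

-- Only one string of length `ℓ` can be a prefix of `Y`, so the sum counts its occurrences in `d`.
sumWindows-isPrefix : ∀ ℓ d Y C → (∀ y → length y ≡ ℓ → occ y d ≤ C) →
  sumWindows ℓ (λ W → bit (isPrefix W Y)) d ≤ C
sumWindows-isPrefix ℓ d Y C bound with ℓ ≤? length Y
... | no  l = ≤-trans (sumWindows-mono ℓ {h′ = λ _ → 0} d λ W lw → ≤-reflexive (cong bit (isPrefix-long W Y (subst (length Y <_) (sym lw) (≰⇒> l)))))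
                      (≤-trans (sumWindows-const ℓ 0 d) (≤-trans (≤-reflexive (*-zeroʳ (length d))) z≤n))
... | yes l = ≤-trans (go d) (bound y ly)
  where
  y  = take ℓ Y
  ly = take-all-length Y l
  here : ∀ s → atStart ℓ (λ W → bit (isPrefix W Y)) s ≤ bit (isPrefix y s)
  here s with ℓ ≤ᵇ length s in eq
  ... | false = z≤n
  ... | true  = bit-mono λ p → subst (λ z → isPrefix z s ≡ true) (sym (y≡ p))
                  (subst (λ z → isPrefix (take ℓ s) z ≡ true) (take++drop≡id ℓ s) (isPrefix-++ (take ℓ s) (drop ℓ s)))
    where
    ls = take-all-length s (≤ᵇ⇒≤ ℓ _ (≡⇒T eq))
    y≡ : isPrefix (take ℓ s) Y ≡ true → y ≡ take ℓ s
    y≡ p with β , e ← isPrefix-sound (take ℓ s) Y p =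
      trans (cong (take ℓ) e) (trans (cong (λ k → take k (take ℓ s ++ β)) (sym ls)) (take-length-++ (take ℓ s) β))
  go : ∀ d → sumWindows ℓ (λ W → bit (isPrefix W Y)) d ≤ occ y d
  go []      = z≤n
  go (a ∷ d) = +-mono-≤ (here (a ∷ d)) (go d)

-- Pairs (window of d, occurrence in x) are counted by the occurrence.
sumWindows-occ : ∀ ℓ d x C → (∀ y → length y ≡ ℓ → occ y d ≤ C) →
  sumWindows ℓ (λ W → occ W x) d ≤ suc (length x) * C
sumWindows-occ ℓ d [] C bound = ≤-trans (sumWindows-isPrefix ℓ d [] C bound) (≤-reflexive (sym (+-identityʳ C)))
sumWindows-occ ℓ d (a ∷ x) C bound = ≤-trans (≤-reflexive (sumWindows-+ ℓ (λ W → bit (isPrefix W (a ∷ x))) (λ W → occ W x) d))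
  (+-mono-≤ (sumWindows-isPrefix ℓ d (a ∷ x) C bound) (sumWindows-occ ℓ d x C bound))

sumWindows-drop₁ : ∀ ℓ h d → sumWindows (2 + ℓ) (h ∘ drop 1) d ≤ sumWindows (1 + ℓ) h (drop 1 d)
sumWindows-drop₁ ℓ h []          = z≤n
sumWindows-drop₁ ℓ h (a ∷ [])    = z≤n
sumWindows-drop₁ ℓ h (a ∷ b ∷ d) = +-monoʳ-≤ (atStart (1 + ℓ) h (b ∷ d)) (sumWindows-drop₁ ℓ h (b ∷ d))

sumWindows-drop : ∀ s ℓ h d → sumWindows (s + suc ℓ) (h ∘ drop s) d ≤ sumWindows (suc ℓ) h d
sumWindows-drop zero    ℓ h d = ≤-refl
sumWindows-drop (suc s) ℓ h d rewrite +-suc s ℓ = begin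
  sumWindows (2 + (s + ℓ)) (h ∘ drop (suc s)) d       ≤⟨ sumWindows-mono (2 + (s + ℓ)) {h′ = h ∘ drop s ∘ drop 1} d (λ W _ → ≤-reflexive (cong h (sym (drop-drop 1 s W)))) ⟩
  sumWindows (2 + (s + ℓ)) (h ∘ drop s ∘ drop 1) d    ≤⟨ sumWindows-drop₁ (s + ℓ) (h ∘ drop s) d ⟩
  sumWindows (1 + (s + ℓ)) (h ∘ drop s) (drop 1 d)    ≤⟨ tail≤ d ⟩
  sumWindows (1 + (s + ℓ)) (h ∘ drop s) d             ≡⟨ cong (λ k → sumWindows k (h ∘ drop s) d) (sym (+-suc s ℓ)) ⟩
  sumWindows (s + suc ℓ) (h ∘ drop s) d               ≤⟨ sumWindows-drop s ℓ h d ⟩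
  sumWindows (suc ℓ) h d                              ∎
  where
  open ≤-Reasoning
  tail≤ : ∀ {ℓ h} d → sumWindows ℓ h (drop 1 d) ≤ sumWindows ℓ h d
  tail≤ []      = z≤n
  tail≤ (a ∷ d) = m≤n+m _ _

take-take-suc : ∀ ℓ (s : Str) → take ℓ (take (suc ℓ) s) ≡ take ℓ s
take-take-suc zero    s       = refl
take-take-suc (suc ℓ) []      = refl
take-take-suc (suc ℓ) (a ∷ s) = cong (a ∷_) (take-take-suc ℓ s)

sumWindows-take : ∀ ℓ h d → sumWindows (suc ℓ) (h ∘ take ℓ) d ≤ sumWindows ℓ h d
sumWindows-take ℓ h []      = z≤n
sumWindows-take ℓ h (a ∷ d) = +-mono-≤ here (sumWindows-take ℓ h d)
  where
  here : atStart (suc ℓ) (h ∘ take ℓ) (a ∷ d) ≤ atStart ℓ h (a ∷ d)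
  here with suc ℓ ≤ᵇ length (a ∷ d) in eq
  ... | false = z≤n
  ... | true rewrite ≤ᵇ-true {ℓ} {length (a ∷ d)} (<⇒≤ (≤ᵇ⇒≤ (suc ℓ) _ (≡⇒T eq))) | take-take-suc ℓ (a ∷ d) = ≤-refl

-- Putting a bit in front splits the occurrences into two classes and misses at most the one at the
-- start: a bound `m` becomes `2 * m + 1`. The `suc` turns this into plain doubling.
occ-unique-short : ∀ {n} d → Unique n d → ∀ j z → j + length z ≡ n → suc (occ z d) ≤ 2 ^ j * 2
occ-unique-short d uq zero z l = s≤s (uq z l)
occ-unique-short d uq (suc j) z l = begin
  suc (occ z d)                                  ≡⟨ cong suc (sym (occ-∷-split z d)) ⟩
  suc (F₀ + T₁ + bit (isPrefix z d))               ≤⟨ s≤s (+-monoʳ-≤ (F₀ + T₁) (bit≤1 _)) ⟩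
  suc (F₀ + T₁ + 1)                                ≡⟨ cong suc (trans (+-assoc F₀ T₁ 1) (cong (F₀ +_) (+-comm T₁ 1))) ⟩
  suc F₀ + suc T₁                                  ≤⟨ +-mono-≤ (rec false) (rec true) ⟩
  2 ^ j * 2 + 2 ^ j * 2                          ≡⟨ trans (double (2 ^ j * 2)) (sym (*-assoc 2 (2 ^ j) 2)) ⟩
  2 ^ suc j * 2                                  ∎
  where
  open ≤-Reasoning
  F₀ = occ (false ∷ z) d
  T₁ = occ (true ∷ z) d
  rec : ∀ b → suc (occ (b ∷ z) d) ≤ 2 ^ j * 2
  rec b = occ-unique-short d uq j (b ∷ z) (trans (+-suc j (length z)) l)

occ-unique-long : ∀ {n} d → Unique n d → ∀ z → n ≤ length z → occ z d ≤ 1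
occ-unique-long {n} d uq z l = ≤-trans (subst (λ s → occ s d ≤ occ (take n z) d) (take++drop≡id n z) (occ-shortenʳ (take n z) (drop n z) d))
  (uq (take n z) (take-all-length z l))

-- Wrong continuations of windows

flipLast : Str → Str
flipLast []          = []
flipLast (a ∷ [])    = not a ∷ []
flipLast (a ∷ b ∷ w) = a ∷ flipLast (b ∷ w)

flipLast-snoc : ∀ e b → flipLast (e ++ [ b ]) ≡ e ++ [ not b ]
flipLast-snoc []          b = refl
flipLast-snoc (a ∷ [])    b = refl
flipLast-snoc (a ∷ c ∷ e) b = cong (a ∷_) (flipLast-snoc (c ∷ e) b)

flipLast-involutive : ∀ w → flipLast (flipLast w) ≡ w
flipLast-involutive []              = refl
flipLast-involutive (a ∷ [])        = cong [_] (not-involutive a)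
flipLast-involutive (a ∷ b ∷ [])    = cong (λ c → a ∷ c ∷ []) (not-involutive b)
flipLast-involutive (a ∷ b ∷ c ∷ w) = cong (a ∷_) (flipLast-involutive (b ∷ c ∷ w))

length-flipLast : ∀ w → length (flipLast w) ≡ length w
length-flipLast []          = refl
length-flipLast (a ∷ [])    = refl
length-flipLast (a ∷ b ∷ w) = cong suc (length-flipLast (b ∷ w))

isPrefix-comparable : ∀ a b y → isPrefix a y ≡ true → isPrefix b y ≡ true → length a ≤ length b → isPrefix a b ≡ true
isPrefix-comparable a b y p q l with β , refl ← isPrefix-sound b y q = trans (sym (isPrefix-++-short a b β l)) p

module Separation (n g : ℕ) (d : Str) (uq : Unique n d) where
  H = n + g

  -- Is 1 if the text starts with an H-window of d followed by the bit that does not follow it in d.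
  wrong : Str → ℕ
  wrong Y = sumWindows (suc H) (λ W → bit (isPrefix (flipLast W) Y)) d

  -- A window whose flip begins `Y` is determined by `Y`: it is the flip of the first `suc H` bits,
  -- and it occurs in `d` at most once.
  wrong≤1 : ∀ Y → wrong Y ≤ 1
  wrong≤1 Y = ≤-trans (sumWindows-mono (suc H) d λ W lw → bit-mono (flipped W lw))
    (sumWindows-isPrefix (suc H) d (flipLast (take (suc H) Y)) 1
      λ y ly → occ-unique-long d uq y (≤-trans (≤-trans (m≤m+n n g) (n≤1+n H)) (≤-reflexive (sym ly))))
    where
    flipped : ∀ W → length W ≡ suc H → isPrefix (flipLast W) Y ≡ true → isPrefix W (flipLast (take (suc H) Y)) ≡ true
    flipped W lw p with β , refl ← isPrefix-sound (flipLast W) Y p =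
      subst (λ V → isPrefix W V ≡ true) (sym V≡) (subst (λ V → isPrefix W V ≡ true) (++-identityʳ W) (isPrefix-++ W []))
      where
      V≡ : flipLast (take (suc H) (flipLast W ++ β)) ≡ W
      V≡ = trans (cong (λ k → flipLast (take k (flipLast W ++ β))) (sym (trans (length-flipLast W) lw)))
             (trans (cong flipLast (take-length-++ (flipLast W) β)) (flipLast-involutive W))

  wrong-[] : wrong [] ≡ 0
  wrong-[] = n≤0⇒n≡0 (≤-trans (sumWindows-mono (suc H) {h′ = λ _ → 0} d λ W lw → ≤-reflexive (cong bit (isPrefix-long (flipLast W) []
      (≤-trans (s≤s z≤n) (≤-reflexive (sym (trans (length-flipLast W) lw)))))))
    (≤-trans (sumWindows-const (suc H) 0 d) (≤-reflexive (*-zeroʳ (length d)))))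

  wrong-factor : ∀ Y → 1 ≤ wrong Y → ∃₂ λ e b → length e ≡ H × isPrefix (e ++ [ not b ]) Y ≡ true × 1 ≤ occ (e ++ [ b ]) d
  wrong-factor Y p with sumWindows-pos (suc H) (λ W → bit (isPrefix (flipLast W) Y)) d p
  ... | W , lw , q , α , β , d≡ with e , b , refl ← unsnoc W lw =
    e , b , suc-injective (trans (sym (length-snoc e b)) lw) ,
    subst (λ V → isPrefix V Y ≡ true) (flipLast-snoc e b) (0<bit⇒true q) ,
    subst (λ s → 1 ≤ occ (e ++ [ b ]) s) (sym d≡) (occ-factor α (e ++ [ b ]) β)

  both-followers : ∀ u b → n ≤ length u → 1 ≤ occ (u ++ [ b ]) d → 1 ≤ occ (u ++ [ not b ]) d → ⊥
  both-followers u b lu p q = 1+n≰n (≤-trans (≤-trans (two b p q) (occ-snoc-split u d)) (occ-unique-long d uq u lu))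
    where
    two : ∀ b → 1 ≤ occ (u ++ [ b ]) d → 1 ≤ occ (u ++ [ not b ]) d → 2 ≤ occ (u ++ [ false ]) d + occ (u ++ [ true ]) d
    two true  p q = +-mono-≤ q p
    two false p q = +-mono-≤ p q

  isPrefix-drop : ∀ s e c Y → s ≤ length e → isPrefix (e ++ [ c ]) Y ≡ true → isPrefix (drop s e ++ [ c ]) (drop s Y) ≡ true
  isPrefix-drop s e c Y s≤ p with β , refl ← isPrefix-sound (e ++ [ c ]) Y p =
    subst (λ Z → isPrefix (drop s e ++ [ c ]) Z ≡ true) (sym (dropped s e s≤)) (isPrefix-++ (drop s e ++ [ c ]) β)
    where
    dropped : ∀ s e → s ≤ length e → drop s ((e ++ [ c ]) ++ β) ≡ (drop s e ++ [ c ]) ++ β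
    dropped zero    e       _       = refl
    dropped (suc s) (a ∷ e) (s≤s l) = dropped s e l

  -- Otherwise the wrong bit and the n bits before it would lie inside the second H-window
  -- of d, although those n bits have only one successor in d.
  wrong-separated : ∀ Y s → 1 ≤ wrong Y → suc s ≤ g → wrong (drop (suc s) Y) ≡ 0
  wrong-separated Y s p s<g with zero⊎pos (wrong (drop (suc s) Y))
  ... | inj₁ e = e
  ... | inj₂ q with e , b , le , pre , in-d ← wrong-factor Y p
                  | e′ , b′ , le′ , pre′ , in-d′ ← wrong-factor (drop (suc s) Y) q =
    ⊥-elim (both-followers u b n≤u occurs-right occurs-wrong)
    where
    u = drop (suc s) e
    s≤H : suc s ≤ length e
    s≤H = ≤-trans (≤-trans s<g (m≤n+m g n)) (≤-reflexive (sym le))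
    lu : suc s + length u ≡ H
    lu = trans (cong (suc s +_) (length-drop (suc s) e)) (trans (m+[n∸m]≡n s≤H) le)
    n≤u : n ≤ length u
    n≤u = ≤-trans (≤-reflexive (sym (m+n∸n≡m n g))) (≤-trans (∸-monoʳ-≤ H s<g)
            (≤-reflexive (trans (cong (_∸ suc s) (sym lu)) (m+n∸m≡n (suc s) (length u)))))
    occurs-right : 1 ≤ occ (u ++ [ b ]) d
    occurs-right = ≤-trans in-d (occ-drop (suc s) e [ b ] d)
    short : length (u ++ [ not b ]) ≤ length e′
    short = ≤-trans (≤-reflexive (length-snoc u (not b))) (≤-trans (≤-trans (s≤s (m≤n+m (length u) s)) (≤-reflexive lu)) (≤-reflexive (sym le′)))
    occurs-wrong : 1 ≤ occ (u ++ [ not b ]) d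
    occurs-wrong with γ , e≡ ← isPrefix-sound (u ++ [ not b ]) e′ (isPrefix-comparable (u ++ [ not b ]) e′ (drop (suc s) Y)
                        (isPrefix-drop (suc s) e (not b) Y s≤H pre) (isPrefix-shorten e′ [ not b′ ] _ pre′) short) =
      ≤-trans (≤-trans in-d′ (occ-shortenʳ e′ [ b′ ] d))
              (subst (λ z → occ z d ≤ occ (u ++ [ not b ]) d) (sym e≡) (occ-shortenʳ (u ++ [ not b ]) γ d))

  -- Organised by windows, as the cost estimate needs it. By `wrongs-∷` it is also the number of
  -- positions of `X` where `wrong` is 1, which is what separation bounds.
  wrongs : Str → ℕ
  wrongs X = sumWindows (suc H) (λ W → occ (flipLast W) X) d

  wrongs-∷ : ∀ a X → wrongs (a ∷ X) ≡ wrong (a ∷ X) + wrongs X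
  wrongs-∷ a X = sumWindows-+ (suc H) (λ W → bit (isPrefix (flipLast W) (a ∷ X))) (λ W → occ (flipLast W) X) d

  -- Along the text, `s` is the number of positions ahead already known to be free. A wrong position
  -- renews it to `g`; the last gap may reach beyond the end of the text, hence `suc g` on the
  -- right.
  wrongs-after-gap : ∀ X s → s ≤ suc g → (∀ j → j < s → wrong (drop j X) ≡ 0) →
    suc g * wrongs X + s ≤ length X + suc g
  wrongs-after-gap [] s s≤ _ rewrite wrong-[] | *-zeroʳ g = s≤
  wrongs-after-gap (a ∷ X) (suc s) s≤ none rewrite wrongs-∷ a X | none 0 z<s | +-suc (suc g * wrongs X) s =
    s≤s (wrongs-after-gap X s (<⇒≤ s≤) λ j j<s → none (suc j) (s<s j<s))
  wrongs-after-gap (a ∷ X) zero s≤ none rewrite wrongs-∷ a X with zero⊎pos (wrong (a ∷ X))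
  ... | inj₁ e rewrite e = ≤-trans (wrongs-after-gap X 0 z≤n λ _ ()) (n≤1+n _)
  ... | inj₂ p rewrite ≤-antisym (wrong≤1 (a ∷ X)) p = begin
    suc g * suc (wrongs X) + 0        ≡⟨ trans (+-identityʳ _) (*-suc (suc g) (wrongs X)) ⟩
    suc g + suc g * wrongs X          ≡⟨ cong suc (+-comm g _) ⟩
    suc (suc g * wrongs X + g)        ≤⟨ s≤s (wrongs-after-gap X g (n≤1+n g) λ j j<g → wrong-separated (a ∷ X) j p j<g) ⟩
    suc (length X + suc g)            ∎
    where open ≤-Reasoning

  wrongs-bound : ∀ X → suc g * wrongs X ≤ length X + suc g
  wrongs-bound X = subst (_≤ length X + suc g) (+-identityʳ _) (wrongs-after-gap X 0 z≤n λ _ ())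

-- The cost of one stage

-- Code lengths are measured in units of 1/K bit.
record Cost (K : ℕ) (f : Frac) (c : ℕ) : Set where
  constructor mkCost
  field cost-bound : proj₂ f ^ K ≤ 2 ^ c * proj₁ f ^ K

open Cost

^-distribʳ-* : ∀ m n o → (m * n) ^ o ≡ m ^ o * n ^ o
^-distribʳ-* m n zero    = refl
^-distribʳ-* m n (suc o) = trans (cong (m * n *_) (^-distribʳ-* m n o)) (lem m n (m ^ o) (n ^ o))
  where
  lem : ∀ a b c d → a * b * (c * d) ≡ a * c * (b * d)
  lem = solve-∀

Cost-⊗ : ∀ K f f′ {c c′} → Cost K f c → Cost K f′ c′ → Cost K (f ⊗ f′) (c + c′)
Cost-⊗ K (p , q) (p′ , q′) {c} {c′} (mkCost h) (mkCost h′) = mkCost (begin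
  (q * q′) ^ K                           ≡⟨ ^-distribʳ-* q q′ K ⟩
  q ^ K * q′ ^ K                         ≤⟨ *-mono-≤ h h′ ⟩
  2 ^ c * p ^ K * (2 ^ c′ * p′ ^ K)      ≡⟨ lem (2 ^ c) (p ^ K) (2 ^ c′) (p′ ^ K) ⟩
  2 ^ c * 2 ^ c′ * (p ^ K * p′ ^ K)      ≡⟨ cong₂ _*_ (sym (^-distribˡ-+-* 2 c c′)) (sym (^-distribʳ-* p p′ K)) ⟩
  2 ^ (c + c′) * (p * p′) ^ K            ∎)
  where
  open ≤-Reasoning
  lem : ∀ a b c d → a * b * (c * d) ≡ a * c * (b * d)
  lem = solve-∀

Cost-mono : ∀ K f {c c′} → c ≤ c′ → Cost K f c → Cost K f c′
Cost-mono K (p , q) le (mkCost h) = mkCost (≤-trans h (*-monoˡ-≤ (p ^ K) (^-monoʳ-≤ 2 le)))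

Cost-one : ∀ K → Cost K (1 , 1) 0
Cost-one K = mkCost (≤-reflexive (sym (+-identityʳ _)))

1≤^ : ∀ {p} K → 1 ≤ p → 1 ≤ p ^ K
1≤^ {suc p} K _ = m^n>0 (suc p) K

Cost-denominator : ∀ K f {c} → 1 ≤ proj₁ f → proj₂ f ^ K ≤ 2 ^ c → Cost K f c
Cost-denominator K (p , q) {c} 1≤p h = mkCost (≤-trans h (≤-trans (≤-reflexive (sym (*-identityʳ (2 ^ c)))) (*-monoʳ-≤ (2 ^ c) (1≤^ K 1≤p))))

Pgo-++ : ∀ x w v → Pgo x (w ++ v) ≡ Pgo x w ⊗ Pgo (x ++ w) v
Pgo-++ x []      v rewrite ++-identityʳ x = cong₂ _,_ (sym (+-identityʳ _)) (sym (+-identityʳ _))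
Pgo-++ x (b ∷ w) v rewrite Pgo-++ (x ++ [ b ]) w v | ++-assoc x [ b ] w =
  cong₂ _,_ (sym (*-assoc (proj₁ (PPM.probBit x b)) _ _)) (sym (*-assoc (proj₂ (PPM.probBit x b)) _ _))

Cost-++ : ∀ K x w v {c c′} → Cost K (Pgo x w) c → Cost K (Pgo (x ++ w) v) c′ → Cost K (Pgo x (w ++ v)) (c + c′)
Cost-++ K x w v h h′ rewrite Pgo-++ x w v = Cost-⊗ K (Pgo x w) (Pgo (x ++ w) v) h h′

-- In quotients, (1 + 1/c)^i ≤ (c + 1)/(c + 1 - i): each factor (c + 1)/c is at most (c + 1 - i)/(c
-- - i) for the current i, and the product telescopes.
suc-^-≤ : ∀ c i → i ≤ suc c → suc c ^ i * (suc c ∸ i) ≤ c ^ i * suc c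
suc-^-≤ c zero    _ = ≤-refl
suc-^-≤ c (suc i) (s≤s i≤c) = begin
  suc c * suc c ^ i * (c ∸ i)         ≡⟨ lem₁ (suc c) (suc c ^ i) (c ∸ i) ⟩
  suc c ^ i * (suc c * (c ∸ i))       ≤⟨ *-monoʳ-≤ (suc c ^ i) le ⟩
  suc c ^ i * (c * (suc c ∸ i))       ≡⟨ lem₂ (suc c ^ i) c (suc c ∸ i) ⟩
  c * (suc c ^ i * (suc c ∸ i))       ≤⟨ *-monoʳ-≤ c (suc-^-≤ c i (m≤n⇒m≤1+n i≤c)) ⟩
  c * (c ^ i * suc c)                 ≡⟨ sym (*-assoc c (c ^ i) (suc c)) ⟩
  c * c ^ i * suc c                   ∎
  where
  open ≤-Reasoning
  lem₁ : ∀ a b d → a * b * d ≡ b * (a * d)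
  lem₁ = solve-∀
  lem₂ : ∀ b c d → b * (c * d) ≡ c * (b * d)
  lem₂ = solve-∀
  le : suc c * (c ∸ i) ≤ c * (suc c ∸ i)
  le rewrite +-∸-assoc 1 i≤c | *-suc c (c ∸ i) = +-monoˡ-≤ (c * (c ∸ i)) (m∸n≤m c i)

-- Since `suc c` is at most twice `suc c ∸ K`, a bit of probability `c / suc c` costs a single unit.
suc-^-≤-double : ∀ K c → 2 * K ≤ c → suc c ^ K ≤ 2 * c ^ K
suc-^-≤-double K c 2K≤c = *-cancelʳ-≤ _ _ (suc c) (begin
  suc c ^ K * suc c                   ≤⟨ *-monoʳ-≤ (suc c ^ K) half ⟩
  suc c ^ K * (2 * (suc c ∸ K))       ≡⟨ lem (suc c ^ K) 2 (suc c ∸ K) ⟩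
  2 * (suc c ^ K * (suc c ∸ K))       ≤⟨ *-monoʳ-≤ 2 (suc-^-≤ c K K≤) ⟩
  2 * (c ^ K * suc c)                 ≡⟨ sym (*-assoc 2 (c ^ K) (suc c)) ⟩
  2 * c ^ K * suc c                   ∎)
  where
  open ≤-Reasoning
  lem : ∀ b c d → b * (c * d) ≡ c * (b * d)
  lem = solve-∀
  K≤ : K ≤ suc c
  K≤ = ≤-trans (m≤m+n K (K + 0)) (≤-trans 2K≤c (n≤1+n c))
  half : suc c ≤ 2 * (suc c ∸ K)
  half = +-cancelʳ-≤ (2 * K) (suc c) _ (begin
    suc c + 2 * K                   ≤⟨ +-monoʳ-≤ (suc c) (≤-trans 2K≤c (n≤1+n c)) ⟩
    suc c + suc c                   ≡⟨ double (suc c) ⟩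
    2 * suc c                       ≡⟨ cong (2 *_) (sym (m∸n+n≡m K≤)) ⟩
    2 * (suc c ∸ K + K)             ≡⟨ *-distribˡ-+ 2 (suc c ∸ K) K ⟩
    2 * (suc c ∸ K) + 2 * K         ∎)

n<2^n : ∀ n → n < 2 ^ n
n<2^n zero    = s≤s z≤n
n<2^n (suc n) = ≤-trans (s≤s (≤-trans (n<2^n n) (≤-reflexive (sym (+-identityʳ _)))))
  (+-monoˡ-≤ (2 ^ n + 0) (m^n>0 2 n))

occ≤length : ∀ w x → occ w x ≤ suc (length x)
occ≤length w []      = bit≤1 _
occ≤length w (a ∷ x) = +-mono-≤ (bit≤1 _) (occ≤length w x)

-- The index is only an upper bound on the number of pieces, so that prefixes keep it.
data Pieces (d : Str) : ℕ → Str → Set where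
  done  : ∀ {j} → Pieces d j []
  piece : ∀ {j ys} α w β → d ≡ α ++ w ++ β → Pieces d j ys → Pieces d (suc j) (w ++ ys)

-- `3 + t` is the order `N` of `d`. `X` is the text up to the point of interest, including the part
-- of the stage already read, and `G` bounds the cost of any bit of the stage. Counts that fix the
-- charge of a window are taken in `X`, so that they do not change while the stage is being read.
module Stage (K a t′ g G : ℕ) (d : Str) (uq : Unique (3 + suc t′) d) (X : Str)
             (Gbound : (length X + 3) ^ (2 * K) ≤ 2 ^ G) where
  t = suc t′
  s = 3 + g
  open Separation (3 + t) g d uq

  instance
    2^a≢0 : NonZero (2 ^ a)
    2^a≢0 = m^n≢0 2 a

  -- For `W = e ++ [ b ]` with `length e = H = s + t` these are the last `t` bits of `e`.
  lastBits : Str → Str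
  lastBits W = take t (drop s W)

  -- Bounds 2K log₂ (q + 2) for the number q of occurrences of the context of length t, by
  -- log₂ (q + 2) ≤ a + (q + 2) / 2^a, which is linear in q and so can be summed over all windows.
  firstVisit : Str → ℕ
  firstVisit W = 2 * K * (a + (occ (lastBits W) X + 2) / 2 ^ a)

  -- From visit 2K + 2 on, a correctly predicted bit costs a single unit, which is accounted for by the length of the text.
  visits : Str → ℕ → ℕ
  visits W zero    = 0
  visits W (suc c) = firstVisit W + K * (c ⊓ (2 * K))

  visits-mono : ∀ W {c c′} → c ≤ c′ → visits W c ≤ visits W c′
  visits-mono W z≤n     = z≤n
  visits-mono W (s≤s l) = +-monoʳ-≤ (firstVisit W) (*-monoʳ-≤ K (⊓-monoˡ-≤ (2 * K) l))

  -- The potential of an amortized argument: a regular bit is paid for by the growth of the `visits`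
  -- of its window. Occurrences before the stage or at irregular positions raise it too, which is
  -- harmless because `visits` is bounded.
  Φ : Str → ℕ
  Φ x = sumWindows (suc H) (λ W → visits W (occ W x)) d

  Φ-mono : ∀ x y → Φ x ≤ Φ (x ++ y)
  Φ-mono x y = sumWindows-mono (suc H) d λ W _ → visits-mono W (occ-≤-++ʳ W x y)

  -- Makes every context of length t non-deterministic, so at most one escape is emitted.
  Ready : Str → Set
  Ready x = ∀ z → length z ≡ suc t → 1 ≤ occ z x

  Ready-++ : ∀ x y → Ready x → Ready (x ++ y)
  Ready-++ x y r z l = ≤-trans (r z l) (occ-≤-++ʳ z x y)

  module _ (x : Str) (ready : Ready x) (x≤ : length x ≤ length X) where
    open PPM x

    t≤len : t ≤ length x
    t≤len = ≮⇒≥ λ lt → 1+n≰n (≤-trans (ready (replicate (suc t) true) (length-replicate (suc t)))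
      (≤-reflexive (occ-long (replicate (suc t) true) x (≤-trans lt (≤-trans (n≤1+n t) (≤-reflexive (sym (length-replicate (suc t)))))))))

    length-suf : length (suf t) ≡ t
    length-suf = trans (length-drop (length x ∸ t) x) (m∸[m∸n]≡n t≤len)

    both : ∀ c → 1 ≤ cnt t c
    both c = ready (suf t ++ [ c ]) (trans (length-snoc (suf t) c) (cong suc length-suf))

    probBit-bound : ∀ b → proj₂ (probBit b) ≤ (occ (suf t) x + 2) * (occ (suf t) x + 2)
    probBit-bound b = ≤-trans (probBit-branching x t b t≤len both) (*-mono-≤ le le)
      where
      le = +-monoˡ-≤ 2 (occ-snoc-split (suf t) x)

    cost-of-square : ∀ b Z c → occ (suf t) x + 2 ≤ Z → Z ^ (2 * K) ≤ 2 ^ c → Cost K (probBit b) c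
    cost-of-square b Z c le h = Cost-denominator K (probBit b) (search-pos x b startLen) (begin
      proj₂ (probBit b) ^ K   ≤⟨ ^-monoˡ-≤ K (≤-trans (probBit-bound b) (*-mono-≤ le le)) ⟩
      (Z * Z) ^ K             ≡⟨ cong (λ k → (Z * k) ^ K) (sym (*-identityʳ Z)) ⟩
      (Z ^ 2) ^ K             ≡⟨ ^-*-assoc Z 2 K ⟩
      Z ^ (2 * K)             ≤⟨ h ⟩
      2 ^ c                   ∎)
      where open ≤-Reasoning

    cost-generic : ∀ b → Cost K (probBit b) G
    cost-generic b = cost-of-square b (length X + 3) G
      (≤-trans (+-monoˡ-≤ 2 (≤-trans (occ≤length (suf t) x) (s≤s x≤))) (≤-reflexive (sym (+-suc (length X) 2)))) Gbound

    cost-first : ∀ b q → occ (suf t) x ≤ q → Cost K (probBit b) (2 * K * (a + (q + 2) / 2 ^ a))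
    cost-first b q le = cost-of-square b (2 ^ e) (2 * K * e) (≤-trans (+-monoˡ-≤ 2 le) q≤)
      (≤-reflexive (trans (^-*-assoc 2 e (2 * K)) (cong (2 ^_) (*-comm e (2 * K)))))
      where
      open ≤-Reasoning
      f = (q + 2) / 2 ^ a
      e = a + f
      q≤ : q + 2 ≤ 2 ^ e
      q≤ = begin
        q + 2                         ≡⟨ m≡m%n+[m/n]*n (q + 2) (2 ^ a) ⟩
        (q + 2) % 2 ^ a + f * 2 ^ a   ≤⟨ +-monoˡ-≤ (f * 2 ^ a) (<⇒≤ (m%n<n (q + 2) (2 ^ a))) ⟩
        suc f * 2 ^ a                 ≤⟨ *-monoˡ-≤ (2 ^ a) (n<2^n f) ⟩
        2 ^ f * 2 ^ a                 ≡⟨ *-comm (2 ^ f) (2 ^ a) ⟩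
        2 ^ a * 2 ^ f                 ≡⟨ sym (^-distribˡ-+-* 2 a f) ⟩
        2 ^ e                         ∎

    -- The probability is `c / suc c` with `c ≥ suc i`: at most one bit, that is, `K` units, and a
    -- single unit once `2 * K ≤ i`.
    cost-repeat : ∀ y e b i → x ≡ y ++ e → occ (e ++ [ not b ]) x ≡ 0 → suc i ≤ occ (e ++ [ b ]) x →
      Cost K (probBit b) K × (2 * K ≤ i → Cost K (probBit b) 1)
    cost-repeat y e b i x≡ none rep = result (probBit-deterministic x (length e) b e≤ cnt-b cnt-not)
      where
      suf-e = suf-++ x y e x≡
      e≤ : length e ≤ length x
      e≤ = ≤-trans (m≤n+m _ (length y)) (≤-reflexive (sym (trans (cong length x≡) (length-++ y))))
      cnt-b : 1 ≤ cnt (length e) b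
      cnt-b = subst (λ z → 1 ≤ occ (z ++ [ b ]) x) (sym suf-e) (≤-trans (s≤s z≤n) rep)
      cnt-not : cnt (length e) (not b) ≡ 0
      cnt-not = trans (cong (λ z → occ (z ++ [ not b ]) x) suf-e) none
      twice : ∀ c → 1 ≤ c → suc c ^ K ≤ 2 ^ K * c ^ K
      twice c p = ≤-trans (^-monoˡ-≤ K (≤-trans (+-monoˡ-≤ c p) (≤-reflexive (double c)))) (≤-reflexive (^-distribʳ-* 2 c K))
      result : (∃ λ c → cnt (length e) b ≤ c × probBit b ≡ (c , suc c)) →
               Cost K (probBit b) K × (2 * K ≤ i → Cost K (probBit b) 1)
      result (c , r≤c , eq) = subst (λ f → Cost K f K × (2 * K ≤ i → Cost K f 1)) (sym eq)
        (mkCost (twice c (≤-trans (s≤s z≤n) si≤c)) , λ 2K≤ → mkCost (suc-^-≤-double K c (≤-trans 2K≤ (<⇒≤ si≤c))))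
        where
        si≤c : suc i ≤ c
        si≤c = ≤-trans rep (≤-trans (≤-reflexive (cong (λ z → occ (z ++ [ b ]) x) (sym suf-e))) r≤c)

    -- If the window has a wrong continuation anywhere in `X`, the generic cost `G` is charged to
    -- that. Otherwise the bit is a first visit or an early repetition, paid by `δ`, or a late
    -- repetition, paid by the single unit.
    cost-regular : ∀ y e b rest → x ≡ y ++ e → length e ≡ H → X ≡ x ++ b ∷ rest →
      ∃ λ δ → visits (e ++ [ b ]) (occ (e ++ [ b ]) x) + δ ≤ visits (e ++ [ b ]) (suc (occ (e ++ [ b ]) x)) ×
              Cost K (probBit b) (1 + δ + G * occ (flipLast (e ++ [ b ])) X)
    cost-regular y e b rest x≡ le X≡ with zero⊎pos (occ (flipLast (e ++ [ b ])) X)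
    ... | inj₂ p = 0 , ≤-trans (≤-reflexive (+-identityʳ _)) (visits-mono (e ++ [ b ]) (n≤1+n _)) ,
      Cost-mono K (probBit b) (≤-trans (≤-trans (≤-reflexive (sym (*-identityʳ G))) (*-monoʳ-≤ G p)) (n≤1+n _)) (cost-generic b)
    ... | inj₁ none = go (occ W x) refl
      where
      W = e ++ [ b ]
      none′ : occ (e ++ [ not b ]) x ≡ 0
      none′ = n≤0⇒n≡0 (≤-trans (occ-≤-++ʳ (e ++ [ not b ]) x (b ∷ rest)) (≤-reflexive
        (trans (cong (occ (e ++ [ not b ])) (sym X≡)) (trans (cong (λ z → occ z X) (sym (flipLast-snoc e b))) none))))
      last≡ : suf t ≡ lastBits W
      last≡ = sym (trans (cong (take t) (drop-snoc s e s≤)) (trans (take-≤-++ t (drop s e) [ b ] (≤-reflexive (sym ldrop)))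
                (trans (cong (λ k → take k (drop s e)) (sym ldrop)) (trans (cong (take (length (drop s e))) (sym (++-identityʳ (drop s e))))
                  (trans (take-length-++ (drop s e) []) (trans (sym (suf-++ x (y ++ take s e) (drop s e) x≡′)) (cong suf ldrop)))))))
        where
        lH : length e ≡ s + t
        lH = trans le (cong (3 +_) (+-comm t g))
        s≤ : s ≤ length e
        s≤ = ≤-trans (m≤m+n s t) (≤-reflexive (sym lH))
        ldrop : length (drop s e) ≡ t
        ldrop = trans (length-drop s e) (trans (cong (_∸ s) lH) (m+n∸m≡n s t))
        drop-snoc : ∀ k (e : Str) → k ≤ length e → drop k (e ++ [ b ]) ≡ drop k e ++ [ b ]
        drop-snoc zero    e       _       = refl
        drop-snoc (suc k) (c ∷ e) (s≤s l) = drop-snoc k e l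
        x≡′ : x ≡ (y ++ take s e) ++ drop s e
        x≡′ = trans x≡ (trans (cong (y ++_) (sym (take++drop≡id s e))) (sym (++-assoc y (take s e) (drop s e))))
      go : ∀ r → occ W x ≡ r → ∃ λ δ → visits W r + δ ≤ visits W (suc r) × Cost K (probBit b) (1 + δ + G * occ (flipLast W) X)
      go zero    eq = firstVisit W , m≤m+n _ _ , Cost-mono K (probBit b) (≤-trans (n≤1+n _) (m≤m+n _ _))
        (cost-first b (occ (lastBits W) X) (≤-trans (≤-reflexive (cong (λ z → occ z x) last≡))
          (≤-trans (occ-≤-++ʳ (lastBits W) x (b ∷ rest)) (≤-reflexive (cong (occ (lastBits W)) (sym X≡))))))
      go (suc i) eq with 2 * K ≤? i
      ... | yes p = 0 , ≤-trans (≤-reflexive (+-identityʳ _)) (visits-mono W (n≤1+n (suc i))) ,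
        Cost-mono K (probBit b) (s≤s z≤n) (proj₂ (cost-repeat y e b i x≡ none′ (≤-reflexive (sym eq))) p)
      ... | no ¬p = K , ≤-reflexive (trans (+-assoc (firstVisit W) _ K) (cong (firstVisit W +_) (incr (≰⇒> ¬p)))) ,
        Cost-mono K (probBit b) (≤-trans (n≤1+n K) (m≤m+n _ _)) (proj₁ (cost-repeat y e b i x≡ none′ (≤-reflexive (sym eq))))
        where
        incr : suc i ≤ 2 * K → K * (i ⊓ (2 * K)) + K ≡ K * (suc i ⊓ (2 * K))
        incr l rewrite m≤n⇒m⊓n≡m l | m≤n⇒m⊓n≡m (<⇒≤ l) = trans (+-comm (K * i) K) (sym (*-suc K i))

  -- On all of `d` this is `wrongs X`; on a substring it charges only the windows of that substring.
  flips : Str → ℕ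
  flips = sumWindows (suc H) (λ W → occ (flipLast W) X)

  length-≤-X : ∀ x w → X ≡ x ++ w → length x ≤ length X
  length-≤-X x w X≡ = ≤-trans (m≤m+n _ (length w)) (≤-reflexive (sym (trans (cong length X≡) (length-++ x))))

  cost-irregular : ∀ w x rest → Ready x → X ≡ x ++ w ++ rest → Cost K (Pgo x w) (length w * G)
  cost-irregular []      x rest r X≡ = Cost-one K
  cost-irregular (b ∷ w) x rest r X≡ = Cost-⊗ K (PPM.probBit x b) (Pgo (x ++ [ b ]) w)
    (cost-generic x r (length-≤-X x _ X≡) b)
    (cost-irregular w (x ++ [ b ]) rest (Ready-++ x [ b ] r) (trans X≡ (sym (++-assoc x [ b ] (w ++ rest)))))

  -- The last `H` bits `e` slide along `d`: as `e ++ r` is a substring of `d`, every `e ++ [ b ]` is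
  -- a window and `cost-regular` applies. The windows met are those of `e ++ r`, whence the term
  -- `flips (e ++ r)`.
  cost-inside : ∀ r y e x α β rest → length e ≡ H → Ready x → x ≡ y ++ e → d ≡ α ++ e ++ r ++ β → X ≡ x ++ r ++ rest →
    ∃ λ c → Cost K (Pgo x r) c × c + Φ x ≤ Φ (x ++ r) + (length r + G * flips (e ++ r))
  cost-inside [] y e x α β rest le rd x≡ d≡ X≡ = 0 , Cost-one K , ≤-trans (Φ-mono x []) (m≤m+n _ _)
  cost-inside (b ∷ r) y (a₀ ∷ e₀) x α β rest le rd x≡ d≡ X≡ =
    combine (cost-regular x rd (length-≤-X x _ X≡) y (a₀ ∷ e₀) b (r ++ rest) x≡ le X≡)
            (cost-inside r (y ++ [ a₀ ]) (e₀ ++ [ b ]) (x ++ [ b ]) (α ++ [ a₀ ]) β rest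
              (trans (length-snoc e₀ b) le) (Ready-++ x [ b ] rd) x≡′ d≡′ (trans X≡ (sym (++-assoc x [ b ] (r ++ rest)))))
    where
    open ≤-Reasoning
    W = a₀ ∷ e₀ ++ [ b ]
    f = occ (flipLast W) X
    lem₁ : ∀ δ u c p → 1 + δ + u + c + p ≡ c + (p + δ) + (1 + u)
    lem₁ = solve-∀
    lem₂ : ∀ p l G v f → p + (l + G * v) + (1 + G * f) ≡ p + (suc l + G * (f + v))
    lem₂ = solve-∀
    x≡′ : x ++ [ b ] ≡ (y ++ [ a₀ ]) ++ e₀ ++ [ b ]
    x≡′ = trans (cong (_++ [ b ]) x≡) (trans (++-assoc y (a₀ ∷ e₀) [ b ]) (sym (++-assoc y [ a₀ ] (e₀ ++ [ b ]))))
    d≡W : d ≡ α ++ a₀ ∷ (e₀ ++ [ b ]) ++ r ++ β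
    d≡W = trans d≡ (cong (λ z → α ++ a₀ ∷ z) (sym (++-assoc e₀ [ b ] (r ++ β))))
    d≡′ : d ≡ (α ++ [ a₀ ]) ++ (e₀ ++ [ b ]) ++ r ++ β
    d≡′ = trans d≡W (sym (++-assoc α [ a₀ ] _))
    length-W : length W ≡ suc H
    length-W = cong suc (trans (length-snoc e₀ b) le)
    flips-∷ : f + flips ((e₀ ++ [ b ]) ++ r) ≡ flips (a₀ ∷ e₀ ++ b ∷ r)
    flips-∷ = trans (cong (_+ flips ((e₀ ++ [ b ]) ++ r)) (sym here)) (cong (λ z → flips (a₀ ∷ z)) (++-assoc e₀ [ b ] r))
      where
      here : atStart (suc H) (λ W → occ (flipLast W) X) (W ++ r) ≡ f
      here rewrite ≤ᵇ-true {suc H} {length (W ++ r)} (≤-trans (≤-reflexive (sym length-W)) (≤-trans (m≤m+n _ _) (≤-reflexive (sym (length-++ W)))))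
        = cong (λ z → occ (flipLast z) X) (trans (cong (λ k → take k (W ++ r)) (sym length-W)) (take-length-++ W r))
    Φ-step : ∀ δ → visits W (occ W x) + δ ≤ visits W (suc (occ W x)) → Φ x + δ ≤ Φ (x ++ [ b ])
    Φ-step δ vis = subst (λ z → sumWindows (suc H) (λ V → visits V (occ V x)) z + δ ≤
                                sumWindows (suc H) (λ V → visits V (occ V (x ++ [ b ]))) z) (sym d≡W)
      (sumWindows-increment _ _ δ α a₀ (e₀ ++ [ b ]) (r ++ β) length-W (λ V → visits-mono V (occ-≤-++ʳ V x [ b ]))
        (≤-trans vis (visits-mono W new)))
      where
      new : suc (occ W x) ≤ occ W (x ++ [ b ])
      new = subst₂ (λ u v → suc (occ W u) ≤ occ W v) (sym x≡) (sym (trans (cong (_++ [ b ]) x≡) (++-assoc y (a₀ ∷ e₀) [ b ])))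
              (occ-append y (a₀ ∷ e₀) b)
    combine : (∃ λ δ → visits W (occ W x) + δ ≤ visits W (suc (occ W x)) × Cost K (PPM.probBit x b) (1 + δ + G * f)) →
      (∃ λ c → Cost K (Pgo (x ++ [ b ]) r) c ×
               c + Φ (x ++ [ b ]) ≤ Φ ((x ++ [ b ]) ++ r) + (length r + G * flips ((e₀ ++ [ b ]) ++ r))) →
      ∃ λ c → Cost K (Pgo x (b ∷ r)) c × c + Φ x ≤ Φ (x ++ b ∷ r) + (suc (length r) + G * flips (a₀ ∷ e₀ ++ b ∷ r))
    combine (δ , vis , cost) (c , cost′ , pot) =
      1 + δ + G * f + c , Cost-⊗ K (PPM.probBit x b) (Pgo (x ++ [ b ]) r) cost cost′ , (begin
        1 + δ + G * f + c + Φ x                                        ≡⟨ lem₁ δ (G * f) c (Φ x) ⟩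
        c + (Φ x + δ) + (1 + G * f)                                    ≤⟨ +-monoˡ-≤ (1 + G * f) (+-monoʳ-≤ c (Φ-step δ vis)) ⟩
        c + Φ (x ++ [ b ]) + (1 + G * f)                               ≤⟨ +-monoˡ-≤ (1 + G * f) pot ⟩
        Φ ((x ++ [ b ]) ++ r) + (length r + G * flips ((e₀ ++ [ b ]) ++ r)) + (1 + G * f)
          ≡⟨ lem₂ (Φ ((x ++ [ b ]) ++ r)) (length r) G (flips ((e₀ ++ [ b ]) ++ r)) f ⟩
        Φ ((x ++ [ b ]) ++ r) + (suc (length r) + G * (f + flips ((e₀ ++ [ b ]) ++ r)))
          ≡⟨ cong₂ (λ u v → Φ u + (suc (length r) + G * v)) (++-assoc x [ b ] r) flips-∷ ⟩
        Φ (x ++ b ∷ r) + (suc (length r) + G * flips (a₀ ∷ e₀ ++ b ∷ r)) ∎)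

  -- The first `H` bits have no full context inside the piece and are paid at `G` each. The windows
  -- of a piece lie at different positions of `d`, so it pays for each wrong continuation in `X` at
  -- most once.
  cost-piece : ∀ α w β x rest → d ≡ α ++ w ++ β → Ready x → X ≡ x ++ w ++ rest →
    ∃ λ c → Cost K (Pgo x w) c × c + Φ x ≤ Φ (x ++ w) + (H * G + G * wrongs X + length w)
  cost-piece α w β x rest d≡ rd X≡ with length w ≤? H
  ... | yes l = length w * G , cost-irregular w x rest rd X≡ , (begin
      length w * G + Φ x                               ≤⟨ +-mono-≤ (*-monoˡ-≤ G l) (Φ-mono x w) ⟩
      H * G + Φ (x ++ w)                               ≡⟨ +-comm (H * G) _ ⟩
      Φ (x ++ w) + H * G                               ≤⟨ +-monoʳ-≤ (Φ (x ++ w)) (≤-trans (m≤m+n _ _) (m≤m+n _ _)) ⟩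
      Φ (x ++ w) + (H * G + G * wrongs X + length w)   ∎)
    where open ≤-Reasoning
  ... | no l = combine (cost-inside r x e (x ++ e) α β rest le (Ready-++ x e rd) refl
                 (trans d≡ (cong (α ++_) (split β))) (trans X≡ (trans (cong (x ++_) (split rest)) (sym (++-assoc x e (r ++ rest))))))
    where
    open ≤-Reasoning
    e = take H w
    r = drop H w
    le : length e ≡ H
    le = take-all-length w (<⇒≤ (≰⇒> l))
    split : ∀ z → w ++ z ≡ e ++ r ++ z
    split z = trans (cong (_++ z) (sym (take++drop≡id H w))) (++-assoc e r z)
    xer : (x ++ e) ++ r ≡ x ++ w
    xer = trans (++-assoc x e r) (cong (x ++_) (take++drop≡id H w))
    lr : length r ≤ length w
    lr = ≤-trans (≤-reflexive (length-drop H w)) (m∸n≤m (length w) H)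
    flips≤ : flips (e ++ r) ≤ wrongs X
    flips≤ = ≤-trans (≤-reflexive (cong flips (take++drop≡id H w)))
      (≤-trans (sumWindows-≤-++ʳ (suc H) _ w β) (≤-trans (sumWindows-≤-++ˡ (suc H) _ α (w ++ β)) (≤-reflexive (cong flips (sym d≡)))))
    lem : ∀ h p l v → h + (p + (l + v)) ≡ p + (h + v + l)
    lem = solve-∀
    combine : (∃ λ c → Cost K (Pgo (x ++ e) r) c × c + Φ (x ++ e) ≤ Φ ((x ++ e) ++ r) + (length r + G * flips (e ++ r))) →
      ∃ λ c → Cost K (Pgo x w) c × c + Φ x ≤ Φ (x ++ w) + (H * G + G * wrongs X + length w)
    combine (c , cost , pot) =
      H * G + c ,
      subst (λ z → Cost K (Pgo x z) (H * G + c)) (take++drop≡id H w)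
        (Cost-++ K x e r (subst (λ k → Cost K (Pgo x e) (k * G)) le
          (cost-irregular e x (r ++ rest) rd (trans X≡ (cong (x ++_) (split rest))))) cost) , (begin
      H * G + c + Φ x                                               ≤⟨ +-monoʳ-≤ (H * G + c) (Φ-mono x e) ⟩
      H * G + c + Φ (x ++ e)                                        ≡⟨ +-assoc (H * G) c _ ⟩
      H * G + (c + Φ (x ++ e))                                      ≤⟨ +-monoʳ-≤ (H * G) pot ⟩
      H * G + (Φ ((x ++ e) ++ r) + (length r + G * flips (e ++ r))) ≤⟨ +-monoʳ-≤ (H * G) (+-mono-≤ (≤-reflexive (cong Φ xer))
                                                                        (+-mono-≤ lr (*-monoʳ-≤ G flips≤))) ⟩
      H * G + (Φ (x ++ w) + (length w + G * wrongs X))              ≡⟨ lem (H * G) (Φ (x ++ w)) (length w) (G * wrongs X) ⟩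
      Φ (x ++ w) + (H * G + G * wrongs X + length w)                ∎)

  cost-pieces : ∀ {j ys} → Pieces d j ys → ∀ x rest → Ready x → X ≡ x ++ ys ++ rest →
    ∃ λ c → Cost K (Pgo x ys) c × c + Φ x ≤ Φ (x ++ ys) + (j * (H * G + G * wrongs X) + length ys)
  cost-pieces done x rest rd X≡ = 0 , Cost-one K , ≤-trans (Φ-mono x []) (m≤m+n _ _)
  cost-pieces (piece {j} {ys} α w β d≡ ps) x rest rd X≡
    with c , cost , pot ← cost-piece α w β x (ys ++ rest) d≡ rd (trans X≡ (cong (x ++_) (++-assoc w ys rest)))
       | c′ , cost′ , pot′ ← cost-pieces ps (x ++ w) rest (Ready-++ x w rd)
                               (trans X≡ (trans (cong (x ++_) (++-assoc w ys rest)) (sym (++-assoc x w (ys ++ rest))))) =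
    c + c′ , Cost-++ K x w ys cost cost′ , (begin
      c + c′ + Φ x                              ≡⟨ lem₁ c c′ (Φ x) ⟩
      c′ + (c + Φ x)                            ≤⟨ +-monoʳ-≤ c′ pot ⟩
      c′ + (Φ (x ++ w) + (B + length w))        ≡⟨ sym (+-assoc c′ _ _) ⟩
      c′ + Φ (x ++ w) + (B + length w)          ≤⟨ +-monoˡ-≤ (B + length w) pot′ ⟩
      Φ ((x ++ w) ++ ys) + (j * B + length ys) + (B + length w)  ≡⟨ lem₂ (Φ ((x ++ w) ++ ys)) (j * B) (length ys) B (length w) ⟩
      Φ ((x ++ w) ++ ys) + (B + j * B + (length w + length ys))  ≡⟨ cong₂ (λ u v → Φ u + (B + j * B + v)) (++-assoc x w ys) (sym (length-++ w)) ⟩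
      Φ (x ++ w ++ ys) + (suc j * B + length (w ++ ys))          ∎)
    where
    open ≤-Reasoning
    B = H * G + G * wrongs X
    lem₁ : ∀ c c′ p → c + c′ + p ≡ c′ + (c + p)
    lem₁ = solve-∀
    lem₂ : ∀ p j l b w → p + (j + l) + (b + w) ≡ p + (b + j + (w + l))
    lem₂ = solve-∀

  firstVisits : ℕ
  firstVisits = sumWindows (suc H) firstVisit d

  Φ-bound : ∀ x → Φ x ≤ firstVisits + length d * (K * (2 * K))
  Φ-bound x = ≤-trans (sumWindows-mono (suc H) d λ W _ → each W (occ W x))
    (≤-trans (≤-reflexive (sumWindows-+ (suc H) firstVisit (λ _ → K * (2 * K)) d)) (+-monoʳ-≤ firstVisits (sumWindows-const (suc H) (K * (2 * K)) d)))
    where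
    each : ∀ W c → visits W c ≤ firstVisit W + K * (2 * K)
    each W zero    = z≤n
    each W (suc c) = +-monoʳ-≤ (firstVisit W) (*-monoʳ-≤ K (m⊓n≤n c (2 * K)))

  -- Multiplied by `2 ^ a`, the rounded quotient in `firstVisit` becomes linear in the count, and
  -- the counts are summed over `d` by `sumWindows-occ`.
  firstVisits-bound : 2 ^ a * firstVisits ≤ 2 * K * (length d * (a * 2 ^ a + 2) + suc (length X) * 15)
  firstVisits-bound = begin
    2 ^ a * firstVisits                                   ≡⟨ sym (sumWindows-* (suc H) (2 ^ a) firstVisit d) ⟩
    sumWindows (suc H) (λ W → 2 ^ a * firstVisit W) d     ≤⟨ sumWindows-mono (suc H) d (λ W _ → each (occ (lastBits W) X)) ⟩
    sumWindows (suc H) (λ W → 2 * K * (a * 2 ^ a + 2 + occ (lastBits W) X)) d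
                                                          ≡⟨ sumWindows-* (suc H) (2 * K) (λ W → a * 2 ^ a + 2 + occ (lastBits W) X) d ⟩
    2 * K * sumWindows (suc H) (λ W → a * 2 ^ a + 2 + occ (lastBits W) X) d
                                                          ≤⟨ *-monoʳ-≤ (2 * K) inner ⟩
    2 * K * (length d * (a * 2 ^ a + 2) + suc (length X) * 15) ∎
    where
    open ≤-Reasoning
    each : ∀ q → 2 ^ a * (2 * K * (a + (q + 2) / 2 ^ a)) ≤ 2 * K * (a * 2 ^ a + 2 + q)
    each q = begin
      2 ^ a * (2 * K * (a + f))             ≡⟨ lem (2 ^ a) (2 * K) a f ⟩
      2 * K * (a * 2 ^ a + f * 2 ^ a)       ≤⟨ *-monoʳ-≤ (2 * K) (+-monoʳ-≤ (a * 2 ^ a) (m/n*n≤m (q + 2) (2 ^ a))) ⟩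
      2 * K * (a * 2 ^ a + (q + 2))         ≡⟨ cong (2 * K *_) (lem′ (a * 2 ^ a) q) ⟩
      2 * K * (a * 2 ^ a + 2 + q)           ∎
      where
      f = (q + 2) / 2 ^ a
      lem : ∀ p k a f → p * (k * (a + f)) ≡ k * (a * p + f * p)
      lem = solve-∀
      lem′ : ∀ p q → p + (q + 2) ≡ p + 2 + q
      lem′ = solve-∀
    occurrences : sumWindows (suc H) (λ W → occ (lastBits W) X) d ≤ suc (length X) * 15
    occurrences = begin
      sumWindows (suc H) (λ W → occ (lastBits W) X) d           ≡⟨ cong (λ k → sumWindows k (λ W → occ (lastBits W) X) d) (trans (cong (4 +_) (+-comm t g)) (sym (+-suc s t))) ⟩
      sumWindows (s + suc t) ((λ V → occ (take t V) X) ∘ drop s) d ≤⟨ sumWindows-drop s t (λ V → occ (take t V) X) d ⟩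
      sumWindows (suc t) (λ V → occ (take t V) X) d             ≤⟨ sumWindows-take t (λ V → occ V X) d ⟩
      -- A string of length `t`, three bits shorter than the order of `d`, occurs in `d` at most
      -- `2 ^ 4 - 1 = 15` times.
      sumWindows t (λ V → occ V X) d                            ≤⟨ sumWindows-occ t d X 15 (λ y ly → s≤s⁻¹ (occ-unique-short d uq 3 y (cong (3 +_) ly))) ⟩
      suc (length X) * 15                                       ∎
    inner : sumWindows (suc H) (λ W → a * 2 ^ a + 2 + occ (lastBits W) X) d ≤ length d * (a * 2 ^ a + 2) + suc (length X) * 15
    inner = ≤-trans (≤-reflexive (sumWindows-+ (suc H) (λ _ → a * 2 ^ a + 2) (λ W → occ (lastBits W) X) d))
              (+-mono-≤ (sumWindows-const (suc H) (a * 2 ^ a + 2) d) occurrences)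

  stage-cost : ∀ {j ys} x → Pieces d j ys → Ready x → X ≡ x ++ ys →
    Cost K (Pgo x ys) (firstVisits + length d * (K * (2 * K)) + (j * (H * G + G * wrongs X) + length ys))
  stage-cost {j} {ys} x ps rd X≡ with c , cost , pot ← cost-pieces ps x [] rd (trans X≡ (cong (x ++_) (sym (++-identityʳ ys)))) =
    Cost-mono K (Pgo x ys) (≤-trans (m≤m+n c (Φ x)) (≤-trans pot (+-monoˡ-≤ _ (Φ-bound (x ++ ys))))) cost

-- The structure of S

Pieces-weaken : ∀ {d j k ys} → j ≤ k → Pieces d j ys → Pieces d k ys
Pieces-weaken l       done             = done
Pieces-weaken (s≤s l) (piece α w β e p) = piece α w β e (Pieces-weaken l p)

Pieces-++ : ∀ {d j k ys zs} → Pieces d j ys → Pieces d k zs → Pieces d (j + k) (ys ++ zs)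
Pieces-++ {j = j} {k} done q = Pieces-weaken (m≤n+m k j) q
Pieces-++ {d} (piece {ys = ys} α w β e p) q = subst (Pieces d _) (sym (++-assoc w ys _)) (piece α w β e (Pieces-++ p q))

take-++ : ∀ m (u v : Str) → take m (u ++ v) ≡ take m u ++ take (m ∸ length u) v
take-++ zero    []      v = refl
take-++ zero    (a ∷ u) v = refl
take-++ (suc m) []      v = refl
take-++ (suc m) (a ∷ u) v = cong (a ∷_) (take-++ m u v)

Pieces-take : ∀ {d j ys} m → Pieces d j ys → Pieces d j (take m ys)
Pieces-take m done rewrite take-[] {A = Bool} m = done
Pieces-take {d} m (piece {ys = ys} α w β e p) rewrite take-++ m w ys =
  piece α (take m w) (drop m w ++ β)
    (trans e (cong (α ++_) (trans (cong (_++ β) (sym (take++drop≡id m w))) (++-assoc (take m w) (drop m w) β))))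
    (Pieces-take (m ∸ length w) p)

-- Each halving moves a factor 2 from the second factor to the first, so the product is right at any
-- fuel.
2^val2F*oddF : ∀ f n → 2 ^ val2F f n * oddF f n ≡ n
2^val2F*oddF zero    n = +-identityʳ n
2^val2F*oddF (suc f) n with (0 <ᵇ n) ∧ (n % 2 ≡ᵇ 0) in eq
... | false = +-identityʳ n
... | true  = begin
  2 * 2 ^ val2F f (n / 2) * oddF f (n / 2)     ≡⟨ *-assoc 2 (2 ^ val2F f (n / 2)) _ ⟩
  2 * (2 ^ val2F f (n / 2) * oddF f (n / 2))   ≡⟨ cong (2 *_) (2^val2F*oddF f (n / 2)) ⟩
  2 * (n / 2)                                  ≡⟨ *-comm 2 (n / 2) ⟩
  n / 2 * 2                                    ≡⟨ cong (_+ n / 2 * 2) (sym (≡ᵇ⇒≡ (n % 2) 0 (≡⇒T (proj₂ (∧-true {0 <ᵇ n} eq))))) ⟩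
  n % 2 + n / 2 * 2                            ≡⟨ sym (m≡m%n+[m/n]*n n 2) ⟩
  n                                            ∎
  where open ≡-Reasoning

Pieces-rotation : ∀ n i → Pieces (db n) 2 (dbRot n i)
Pieces-rotation n i = subst (Pieces (db n) 2) (cong (drop i (db n) ++_) (++-identityʳ (take i (db n))))
  (piece (take i (db n)) (drop i (db n)) [] (sym (trans (cong (take i (db n) ++_) (++-identityʳ _)) (take++drop≡id i (db n))))
    (piece [] (take i (db n)) (drop i (db n)) (sym (take++drop≡id i (db n))) done))

Pieces-pow : ∀ {d j w} t → Pieces d j w → Pieces d (t * j) (pow w t)
Pieces-pow zero    p = done
Pieces-pow (suc t) p = Pieces-++ p (Pieces-pow t p)

Pieces-concat-map : ∀ {d j} (f : ℕ → Str) → (∀ i → Pieces d j (f i)) → ∀ is → Pieces d (length is * j) (concat (map f is))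
Pieces-concat-map f p []       = done
Pieces-concat-map f p (i ∷ is) = Pieces-++ (p i) (Pieces-concat-map f p is)

Pieces-Sblock : ∀ n → Pieces (db n) (n * 2) (Sblock n)
Pieces-Sblock n = subst (λ k → Pieces (db n) k (Sblock n)) count
  (Pieces-concat-map _ (λ i → Pieces-pow (oddPart n) (Pieces-rotation n i)) (upTo (2 ^ val2 n)))
  where
  count : length (upTo (2 ^ val2 n)) * (oddPart n * 2) ≡ n * 2
  count = trans (cong (_* (oddPart n * 2)) (length-upTo (2 ^ val2 n)))
            (trans (sym (*-assoc (2 ^ val2 n) (oddPart n) 2)) (cong (_* 2) (2^val2F*oddF n n)))

length-pow : ∀ w t → length (pow w t) ≡ t * length w
length-pow w zero    = refl
length-pow w (suc t) = trans (length-++ w) (cong (length w +_) (length-pow w t))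

length-concat-map : ∀ {ℓ} (f : ℕ → Str) → (∀ i → length (f i) ≡ ℓ) → ∀ is → length (concat (map f is)) ≡ length is * ℓ
length-concat-map f p []       = refl
length-concat-map f p (i ∷ is) = trans (length-++ (f i)) (cong₂ _+_ (p i) (length-concat-map f p is))

length-dbRot : ∀ n i → length (dbRot n i) ≡ length (db n)
length-dbRot n i = trans (length-++ (drop i (db n))) (trans (+-comm (length (drop i (db n))) _)
  (trans (sym (length-++ (take i (db n)))) (cong length (take++drop≡id i (db n)))))

length-Sblock : ∀ N → length (Sblock (suc N)) ≡ suc N * 2 ^ suc N
length-Sblock N = begin
  length (Sblock n)                                              ≡⟨ length-concat-map _ (λ i → trans (length-pow (dbRot n i) (oddPart n))
                                                                      (cong (oddPart n *_) (trans (length-dbRot n i) (length-db N)))) (upTo (2 ^ val2 n)) ⟩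
  length (upTo (2 ^ val2 n)) * (oddPart n * 2 ^ n)               ≡⟨ cong (_* (oddPart n * 2 ^ n)) (length-upTo (2 ^ val2 n)) ⟩
  2 ^ val2 n * (oddPart n * 2 ^ n)                               ≡⟨ sym (*-assoc (2 ^ val2 n) (oddPart n) (2 ^ n)) ⟩
  2 ^ val2 n * oddPart n * 2 ^ n                                 ≡⟨ cong (_* 2 ^ n) (2^val2F*oddF n n) ⟩
  n * 2 ^ n                                                      ∎
  where
  open ≡-Reasoning
  n = suc N

db-in-Sblock : ∀ N z → occ z (db (suc N)) ≤ occ z (Sblock (suc N))
db-in-Sblock N z = go (2 ^ val2 n) (oddPart n) (m^n>0 2 (val2 n)) odd≥1
  where
  n = suc N
  odd≥1 : 1 ≤ oddPart n
  odd≥1 with zero⊎pos (oddPart n)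
  ... | inj₂ p = p
  ... | inj₁ e = ⊥-elim (0≢1+n (trans (sym (trans (cong (2 ^ val2 n *_) e) (*-zeroʳ (2 ^ val2 n)))) (2^val2F*oddF n n)))
  go : ∀ k t → 1 ≤ k → 1 ≤ t → occ z (db n) ≤ occ z (concat (map (λ i → pow (dbRot n i) t) (upTo k)))
  -- `dbRot n 0` is `db n ++ []`, so the first copy already contains `db n`.
  go (suc k) (suc t) _ _ = ≤-trans (occ-≤-++ʳ z (db n) []) (≤-trans (occ-≤-++ʳ z (dbRot n 0) _) (occ-≤-++ʳ z (pow (dbRot n 0) (suc t)) _))

Sprefix : ℕ → Str
Sprefix n = concat (map (λ i → Sblock (suc i)) (upTo n))

Sprefix-suc : ∀ n → Sprefix (suc n) ≡ Sprefix n ++ Sblock (suc n)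
Sprefix-suc n = begin
  concat (map f (upTo (suc n)))            ≡⟨ cong (concat ∘ map f) (sym (upTo-∷ʳ n)) ⟩
  concat (map f (upTo n ++ [ n ]))         ≡⟨ cong concat (map-++ f (upTo n) [ n ]) ⟩
  concat (map f (upTo n) ++ [ f n ])       ≡⟨ sym (concat-++ (map f (upTo n)) [ f n ]) ⟩
  Sprefix n ++ f n ++ []                   ≡⟨ cong (Sprefix n ++_) (++-identityʳ (f n)) ⟩
  Sprefix n ++ f n                         ∎
  where
  open ≡-Reasoning
  f = λ i → Sblock (suc i)

Sprefix-≤ : ∀ n j → ∃ λ rest → Sprefix (j + n) ≡ Sprefix n ++ rest
Sprefix-≤ n zero    = [] , sym (++-identityʳ _)
Sprefix-≤ n (suc j) with rest , e ← Sprefix-≤ n j =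
  rest ++ Sblock (suc (j + n)) , trans (Sprefix-suc (j + n)) (trans (cong (_++ Sblock (suc (j + n))) e) (++-assoc (Sprefix n) rest _))

len : ℕ → ℕ
len n = length (Sprefix n)

len-suc : ∀ n → len (suc n) ≡ len n + suc n * 2 ^ suc n
len-suc n = trans (cong length (Sprefix-suc n)) (trans (length-++ (Sprefix n)) (cong (len n +_) (length-Sblock n)))

len-lower : ∀ n → n * 2 ^ n ≤ len n
len-lower zero    = z≤n
len-lower (suc n) = ≤-trans (m≤n+m _ (len n)) (≤-reflexive (sym (len-suc n)))

len-upper : ∀ n → len n ≤ n * 2 ^ suc n
len-upper zero    = z≤n
len-upper (suc n) = begin
  len (suc n)                              ≡⟨ len-suc n ⟩
  len n + suc n * 2 ^ suc n                ≤⟨ +-monoˡ-≤ _ (≤-trans (len-upper n) (*-monoˡ-≤ (2 ^ suc n) (n≤1+n n))) ⟩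
  suc n * 2 ^ suc n + suc n * 2 ^ suc n    ≡⟨ sym (*-distribˡ-+ (suc n) (2 ^ suc n) (2 ^ suc n)) ⟩
  suc n * (2 ^ suc n + 2 ^ suc n)          ≡⟨ cong (suc n *_) (double (2 ^ suc n)) ⟩
  suc n * 2 ^ suc (suc n)                  ∎
  where open ≤-Reasoning

len-< : ∀ n → len n < len (suc n)
len-< n = ≤-trans (≤-trans (≤-reflexive (+-comm 1 (len n))) (+-monoʳ-≤ (len n) (*-mono-≤ (s≤s (z≤n {n})) (m^n>0 2 (suc n)))))
                  (≤-reflexive (sym (len-suc n)))

len-mono : ∀ {m n} → m ≤ n → len m ≤ len n
len-mono {m} {n} m≤n with rest , e ← Sprefix-≤ m (n ∸ m) =
  ≤-trans (m≤m+n (len m) (length rest)) (≤-reflexive (trans (sym (length-++ (Sprefix m))) (trans (cong length (sym e)) (cong len (m∸n+n≡m m≤n)))))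

stage-of : ∀ m → ∃ λ n → len n ≤ m × m < len (suc n)
stage-of zero = 0 , z≤n , len-< 0
stage-of (suc m) with n , l , u ← stage-of m with suc m <? len (suc n)
... | yes v = n , m≤n⇒m≤1+n l , v
... | no ¬v = suc n , ≮⇒≥ ¬v , ≤-trans (s≤s u) (len-< (suc n))

take-beyond : ∀ (u v : Str) r → take (length u + r) (u ++ v) ≡ u ++ take r v
take-beyond []      v r = refl
take-beyond (a ∷ u) v r = cong (a ∷_) (take-beyond u v r)

-- `prefixS m` is cut from the first `m` blocks; `suc n ≤ m` puts block `suc n` among them.
prefixS-split : ∀ n m → suc n ≤ m → len n ≤ m → m < len (suc n) →
  prefixS m ≡ Sprefix n ++ take (m ∸ len n) (Sblock (suc n))
prefixS-split n m n<m l u with rest , e ← Sprefix-≤ (suc n) (m ∸ suc n) = begin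
  take m (Sprefix m)                                     ≡⟨ cong (λ k → take m (Sprefix k)) (sym (m∸n+n≡m n<m)) ⟩
  take m (Sprefix (m ∸ suc n + suc n))                   ≡⟨ cong (take m) e ⟩
  take m (Sprefix (suc n) ++ rest)                       ≡⟨ take-≤-++ m (Sprefix (suc n)) rest (<⇒≤ u) ⟩
  take m (Sprefix (suc n))                               ≡⟨ cong₂ take (sym (m+[n∸m]≡n l)) (Sprefix-suc n) ⟩
  take (len n + (m ∸ len n)) (Sprefix n ++ Sblock (suc n)) ≡⟨ take-beyond (Sprefix n) (Sblock (suc n)) (m ∸ len n) ⟩
  Sprefix n ++ take (m ∸ len n) (Sblock (suc n))         ∎
  where open ≡-Reasoning

-- Numerical bounds

-- With `q = n / k` one has `n ≤ k * suc q` and `suc q ≤ 2 ^ q`; the `k`-th power turns `2 ^ q` into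
-- at most `2 ^ n`.
n^k≤k^k*2^n : ∀ k .{{_ : NonZero k}} n → n ^ k ≤ k ^ k * 2 ^ n
n^k≤k^k*2^n k n = begin
  n ^ k                  ≤⟨ ^-monoˡ-≤ k n≤ ⟩
  (k * suc q) ^ k        ≡⟨ ^-distribʳ-* k (suc q) k ⟩
  k ^ k * suc q ^ k      ≤⟨ *-monoʳ-≤ (k ^ k) (^-monoˡ-≤ k (n<2^n q)) ⟩
  k ^ k * (2 ^ q) ^ k    ≡⟨ cong (k ^ k *_) (^-*-assoc 2 q k) ⟩
  k ^ k * 2 ^ (q * k)    ≤⟨ *-monoʳ-≤ (k ^ k) (^-monoʳ-≤ 2 (m/n*n≤m n k)) ⟩
  k ^ k * 2 ^ n          ∎
  where
  open ≤-Reasoning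
  q = n / k
  n≤ : n ≤ k * suc q
  n≤ = begin
    n              ≡⟨ m≡m%n+[m/n]*n n k ⟩
    n % k + q * k  ≤⟨ +-monoˡ-≤ (q * k) (<⇒≤ (m%n<n n k)) ⟩
    suc q * k      ≡⟨ *-comm (suc q) k ⟩
    k * suc q      ∎

-- The lower-order coefficients of `2 ^ N` in `stage-bound`: the part of the first visits that does
-- not depend on counts, the early repetitions, the wrong continuations, and the terms in `N ^ 5`,
-- which `B` compares with `2 ^ N`.
stageConst : ℕ → ℕ → ℕ → ℕ
stageConst K a B = 2 * K * (a + 2) + K * (2 * K) + 40 * K + 80 * K * B

-- P = 2^N and A = 2^a; F is the cost of the first visits, Wr the number of wrong continuations,
-- ℓX and ℓy are the lengths of the text read and of its part in stage N.
module StageArithmetic (K a B N P A Wr F ℓX ℓy : ℕ) (N≥1 : 1 ≤ N) (P≥1 : 1 ≤ P) (A≥ : 90 * K ≤ A) (A≥1 : 1 ≤ A)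
  (N⁵≤ : N ^ 5 ≤ B * P) (ℓX≤ : ℓX ≤ N * (2 * P))
  (F≤ : A * F ≤ 2 * K * (P * (a * A + 2) + suc ℓX * 15))
  (Wr≤ : suc (N ^ 3) * Wr ≤ ℓX + suc (N ^ 3)) (ℓy≤ : ℓy ≤ N * P) where
  open ≤-Reasoning

  G = 2 * K * (2 * N + 3)

  NP≥1 : 1 ≤ N * P
  NP≥1 = *-mono-≤ N≥1 P≥1

  F-bound : F ≤ N * P + 2 * K * (a + 2) * P
  F-bound = *-cancelˡ-≤ A {{>-nonZero A≥1}} (begin
    A * F                                                   ≤⟨ F≤ ⟩
    2 * K * (P * (a * A + 2) + suc ℓX * 15)                 ≤⟨ *-monoʳ-≤ (2 * K) (+-mono-≤ (*-monoʳ-≤ P (+-monoʳ-≤ (a * A) (*-monoʳ-≤ 2 A≥1)))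
                                                                (*-monoˡ-≤ 15 (+-mono-≤ NP≥1 ℓX≤))) ⟩
    2 * K * (P * (a * A + 2 * A) + (N * P + N * (2 * P)) * 15) ≡⟨ lem K P a A N ⟩
    -- `90 * K` is `2 * K * 15 * 3`, the 3 coming from `suc ℓX ≤ 3 * (N * P)`; dominating it by `A`
    -- is what fixes the size of `a`.
    90 * K * (N * P) + A * (2 * K * (a + 2) * P)            ≤⟨ +-monoˡ-≤ _ (*-monoˡ-≤ (N * P) A≥) ⟩
    A * (N * P) + A * (2 * K * (a + 2) * P)                 ≡⟨ sym (*-distribˡ-+ A (N * P) _) ⟩
    A * (N * P + 2 * K * (a + 2) * P)                       ∎)
    where
    lem : ∀ K P a A N → 2 * K * (P * (a * A + 2 * A) + (N * P + N * (2 * P)) * 15) ≡ 90 * K * (N * P) + A * (2 * K * (a + 2) * P)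
    lem = solve-∀

  N≤N^ : ∀ i → N ≤ N ^ suc i
  N≤N^ i = ≤-trans (≤-reflexive (sym (*-identityʳ N))) (*-monoʳ-≤ N (1≤^ i N≥1))

  G≤ : G ≤ 10 * K * N
  G≤ = ≤-trans (*-monoʳ-≤ (2 * K) (+-monoʳ-≤ (2 * N) (*-monoʳ-≤ 3 N≥1))) (≤-reflexive (lem K N))
    where
    lem : ∀ K N → 2 * K * (2 * N + 3 * N) ≡ 10 * K * N
    lem = solve-∀

  -- `2 * N` pieces have at most `N + N ^ 3 ≤ 2 * N ^ 3` irregular bits each, at cost
  -- `G ≤ 10 * K * N`.
  irregular-bound : N * 2 * ((N + N ^ 3) * G) ≤ 40 * K * N ^ 5
  irregular-bound = ≤-trans (*-monoʳ-≤ (N * 2) (*-mono-≤ (+-monoˡ-≤ (N ^ 3) (N≤N^ 2)) G≤)) (≤-reflexive (lem K N))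
    where
    lem : ∀ K N → N * 2 * (((N * (N * (N * 1))) + (N * (N * (N * 1)))) * (10 * K * N)) ≡ 40 * K * (N * (N * (N * (N * (N * 1)))))
    lem = solve-∀

  N²Wr≤ : N * N * Wr ≤ 2 * P + N * N + 1
  N²Wr≤ = *-cancelˡ-≤ N {{>-nonZero N≥1}} (begin
    N * (N * N * Wr)             ≡⟨ lem₁ N Wr ⟩
    N ^ 3 * Wr                   ≤⟨ m≤n+m _ Wr ⟩
    suc (N ^ 3) * Wr             ≤⟨ Wr≤ ⟩
    ℓX + suc (N ^ 3)             ≤⟨ +-mono-≤ ℓX≤ (+-monoˡ-≤ (N ^ 3) N≥1) ⟩
    N * (2 * P) + (N + N ^ 3)    ≡⟨ lem₂ N P ⟩
    N * (2 * P + N * N + 1)      ∎)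
    where
    lem₁ : ∀ N W → N * (N * N * W) ≡ (N * (N * (N * 1))) * W
    lem₁ = solve-∀
    lem₂ : ∀ N P → N * (2 * P) + (N + (N * (N * (N * 1)))) ≡ N * (2 * P + N * N + 1)
    lem₂ = solve-∀

  -- Each wrong continuation is charged `G`, of order `N`, in each of `2 * N` pieces; the gap
  -- `N ^ 3` brings `N * N * Wr` down to order `P + N * N`.
  wrong-bound : N * 2 * (G * Wr) ≤ 40 * K * P + 40 * K * N ^ 5
  wrong-bound = begin
    N * 2 * (G * Wr)                     ≤⟨ *-monoʳ-≤ (N * 2) (*-monoˡ-≤ Wr G≤) ⟩
    N * 2 * (10 * K * N * Wr)            ≡⟨ lem₁ N K Wr ⟩
    20 * K * (N * N * Wr)                ≤⟨ *-monoʳ-≤ (20 * K) N²Wr≤ ⟩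
    20 * K * (2 * P + N * N + 1)         ≤⟨ *-monoʳ-≤ (20 * K) (+-mono-≤ (+-monoʳ-≤ (2 * P) N²≤) (1≤^ 5 N≥1)) ⟩
    20 * K * (2 * P + N ^ 5 + N ^ 5)     ≡⟨ lem₂ K P (N ^ 5) ⟩
    40 * K * P + 40 * K * N ^ 5          ∎
    where
    lem₁ : ∀ N K W → N * 2 * (10 * K * N * W) ≡ 20 * K * (N * N * W)
    lem₁ = solve-∀
    lem₂ : ∀ K P Q → 20 * K * (2 * P + Q + Q) ≡ 40 * K * P + 40 * K * Q
    lem₂ = solve-∀
    N²≤ : N * N ≤ N ^ 5
    N²≤ = *-monoʳ-≤ N (N≤N^ 3)

  -- Only two terms are of order `N * P`: the part of the first visits that grows with the counts,
  -- and the one unit per bit in `ℓy`. Neither carries a factor `K`, which is why a large `K` makes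
  -- the rate small.
  stage-bound : F + P * (K * (2 * K)) + (N * 2 * ((N + N ^ 3) * G + G * Wr) + ℓy) ≤ (2 * N + stageConst K a B) * P
  stage-bound = begin
    F + P * (K * (2 * K)) + (N * 2 * ((N + N ^ 3) * G + G * Wr) + ℓy)
      ≡⟨ cong (λ k → F + P * (K * (2 * K)) + (k + ℓy)) (*-distribˡ-+ (N * 2) ((N + N ^ 3) * G) (G * Wr)) ⟩
    F + P * (K * (2 * K)) + (N * 2 * ((N + N ^ 3) * G) + N * 2 * (G * Wr) + ℓy)
      ≤⟨ +-mono-≤ (+-monoˡ-≤ _ F-bound) (+-mono-≤ (+-mono-≤ irregular-bound wrong-bound) ℓy≤) ⟩
    N * P + 2 * K * (a + 2) * P + P * (K * (2 * K)) + (40 * K * N ^ 5 + (40 * K * P + 40 * K * N ^ 5) + N * P)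
      ≡⟨ lem₁ N P K a (N ^ 5) ⟩
    (2 * N + 2 * K * (a + 2) + K * (2 * K) + 40 * K) * P + 80 * K * N ^ 5
      ≤⟨ +-monoʳ-≤ _ (*-monoʳ-≤ (80 * K) N⁵≤) ⟩
    (2 * N + 2 * K * (a + 2) + K * (2 * K) + 40 * K) * P + 80 * K * (B * P)
      ≡⟨ lem₂ N P K a B ⟩
    (2 * N + stageConst K a B) * P ∎
    where
    lem₁ : ∀ N P K a Q → N * P + 2 * K * (a + 2) * P + P * (K * (2 * K)) + (40 * K * Q + (40 * K * P + 40 * K * Q) + N * P)
                        ≡ (2 * N + 2 * K * (a + 2) + K * (2 * K) + 40 * K) * P + 80 * K * Q
    lem₁ = solve-∀
    lem₂ : ∀ N P K a B → (2 * N + 2 * K * (a + 2) + K * (2 * K) + 40 * K) * P + 80 * K * (B * P)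
                        ≡ (2 * N + (2 * K * (a + 2) + K * (2 * K) + 40 * K + 80 * K * B)) * P
    lem₂ = solve-∀

cost-in-stage : ∀ K t′ r → let N = 4 + t′ in
  Cost K (Pgo (Sprefix (3 + t′)) (take r (Sblock N))) ((2 * N + stageConst K (90 * K) (5 ^ 5)) * 2 ^ N)
cost-in-stage K t′ r = Cost-mono K (Pgo x ys)
  (≤-trans (≤-reflexive (cong (λ k → firstVisits + k * (K * (2 * K)) + (N * 2 * ((N + g) * G + G * wrongs X) + length ys)) (length-db (3 + t′))))
    (StageArithmetic.stage-bound K a (5 ^ 5) N (2 ^ N) (2 ^ a) (wrongs X) firstVisits (length X) (length ys)
      (s≤s z≤n) (m^n>0 2 N) (<⇒≤ (n<2^n a)) (m^n>0 2 a) (n^k≤k^k*2^n 5 N) lX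
      (≤-trans firstVisits-bound (≤-reflexive (cong (λ k → 2 * K * (k * (a * 2 ^ a + 2) + suc (length X) * 15)) (length-db (3 + t′)))))
      (wrongs-bound X) ly))
  (stage-cost x (Pieces-take r (Pieces-Sblock N)) ready refl)
  where
  N  = 4 + t′
  -- Gives `90 * K ≤ 2 ^ a` by `n<2^n`, with `a` independent of `N`.
  a  = 90 * K
  g  = N ^ 3
  G  = 2 * K * (2 * N + 3)
  x  = Sprefix (3 + t′)
  ys = take r (Sblock N)
  X  = x ++ ys
  ly : length ys ≤ N * 2 ^ N
  ly = ≤-trans (≤-reflexive (length-take r (Sblock N))) (≤-trans (m⊓n≤n r _) (≤-reflexive (length-Sblock (3 + t′))))
  lX : length X ≤ N * (2 * 2 ^ N)
  lX = ≤-trans (≤-reflexive (length-++ x)) (≤-trans (+-monoʳ-≤ (len (3 + t′)) ly)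
         (≤-trans (≤-reflexive (sym (len-suc (3 + t′)))) (len-upper N)))
  Gbound : (length X + 3) ^ (2 * K) ≤ 2 ^ G
  Gbound = begin
    (length X + 3) ^ (2 * K)            ≤⟨ ^-monoˡ-≤ (2 * K) X+3≤ ⟩
    (2 ^ (2 * N + 3)) ^ (2 * K)         ≡⟨ ^-*-assoc 2 (2 * N + 3) (2 * K) ⟩
    2 ^ ((2 * N + 3) * (2 * K))         ≡⟨ cong (2 ^_) (*-comm (2 * N + 3) (2 * K)) ⟩
    2 ^ G                               ∎
    where
    open ≤-Reasoning
    p = 2 ^ N
    p*p≥1 : 1 ≤ p * p
    p*p≥1 = *-mono-≤ (m^n>0 2 N) (m^n>0 2 N)
    lem : ∀ p → p * (2 * p) + 3 * (p * p) + 3 * (p * p) ≡ p * p * 8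
    lem = solve-∀
    X+3≤ : length X + 3 ≤ 2 ^ (2 * N + 3)
    X+3≤ = begin
      length X + 3                      ≤⟨ +-mono-≤ (≤-trans lX (*-monoˡ-≤ (2 * p) (<⇒≤ (n<2^n N)))) (*-monoʳ-≤ 3 p*p≥1) ⟩
      p * (2 * p) + 3 * (p * p)         ≤⟨ m≤m+n _ _ ⟩
      p * (2 * p) + 3 * (p * p) + 3 * (p * p) ≡⟨ lem p ⟩
      p * p * 8                         ≡⟨ cong (_* 8) (sym (trans (cong (2 ^_) (sym (double N))) (^-distribˡ-+-* 2 N N))) ⟩
      2 ^ (2 * N) * 8                   ≡⟨ sym (^-distribˡ-+-* 2 (2 * N) 3) ⟩
      2 ^ (2 * N + 3)                   ∎
  open Stage K a t′ g G (db N) (db-unique (3 + t′)) X Gbound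
  open Separation (4 + t′) g (db N) (db-unique (3 + t′)) using (wrongs; wrongs-bound)
  ready : Ready x
  ready z lz = ≤-trans (db-contains (2 + t′) z lz) (≤-trans (db-in-Sblock (2 + t′) z)
    (≤-trans (occ-≤-++ˡ z (Sprefix (2 + t′)) (Sblock (3 + t′))) (≤-reflexive (cong (occ z) (sym (Sprefix-suc (2 + t′)))))))

-- Adding up the stages

Pgo-pos : ∀ x w → 1 ≤ proj₁ (Pgo x w)
Pgo-pos x []      = ≤-refl
Pgo-pos x (b ∷ w) = *-mono-≤ (search-pos x b (PPM.startLen x)) (Pgo-pos (x ++ [ b ]) w)

-- A crude bound for the stages before the fourth, by `q < 2 ^ q` for the denominator `q`; all that
-- matters is that it is a constant.
Cost-trivial : ∀ K y → Cost K (P y) (proj₂ (P y) * K)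
Cost-trivial K y = Cost-denominator K (P y) (Pgo-pos [] y)
  (≤-trans (^-monoˡ-≤ K (<⇒≤ (n<2^n (proj₂ (P y))))) (≤-reflexive (^-*-assoc 2 (proj₂ (P y)) K)))

StageBound : ℕ → ℕ → (ℕ → Str) → (ℕ → Str) → Set
StageBound K c x s = ∀ i r → Cost K (Pgo (x i) (take r (s i))) ((2 * (4 + i) + c) * 2 ^ (4 + i))

module Total (K C₀ c : ℕ) (x s : ℕ → Str) (x-suc : ∀ i → x (suc i) ≡ x i ++ s i)
             (stage : StageBound K c x s) (start : Cost K (P (x 0)) C₀) where

  -- The bounds for the stages at least double from one to the next, so their sum is at most twice
  -- the last: hence the coefficients 4 and 2 in place of 2 and 1.
  full : ∀ i → Cost K (P (x i)) (C₀ + (4 * (3 + i) + 2 * c) * 2 ^ (3 + i))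
  full zero    = Cost-mono K (P (x 0)) (m≤m+n C₀ _) start
  full (suc i) = subst (λ z → Cost K (P z) _) (sym (x-suc i))
    (Cost-mono K (P (x i ++ s i)) (≤-trans (m≤m+n _ (2 * 2 ^ (4 + i))) (≤-reflexive (lem C₀ c i (2 ^ (3 + i)))))
      (Cost-++ K [] (x i) (s i) (full i)
        (subst (λ y → Cost K (Pgo (x i) y) _) (take-all (length (s i)) (s i) ≤-refl) (stage i (length (s i))))))
    where
    lem : ∀ C c i p → C + (4 * (3 + i) + 2 * c) * p + (2 * (4 + i) + c) * (2 * p) + 2 * (2 * p)
                    ≡ C + (4 * (4 + i) + 2 * c) * (2 * p)
    lem = solve-∀

  partial : ∀ i r → Cost K (P (x i ++ take r (s i))) (C₀ + (8 * (3 + i) + 4 + 4 * c) * 2 ^ (3 + i))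
  partial i r = Cost-mono K (P (x i ++ take r (s i))) (≤-reflexive (lem C₀ c i (2 ^ (3 + i))))
    (Cost-++ K [] (x i) (take r (s i)) (full i) (stage i r))
    where
    lem : ∀ C c i p → C + (4 * (3 + i) + 2 * c) * p + (2 * (4 + i) + c) * (2 * p)
                    ≡ C + (8 * (3 + i) + 4 + 4 * c) * p
    lem = solve-∀

-- The factor 4 is the overhead of two bits, that is, `2 * K` units.
code-length≤cost : ∀ K f ℓ {c} → 1 ≤ proj₁ f → Cost K f c → 2 ^ ℓ * proj₁ f ≤ 4 * proj₂ f → ℓ * K ≤ 2 * K + c
code-length≤cost K (p , q) ℓ {c} p≥1 (mkCost h) code = ≮⇒≥ λ lt → <⇒≱ (^-monoʳ-< 2 ≤-refl lt)
  (*-cancelʳ-≤ _ _ (p ^ K) {{>-nonZero (1≤^ K p≥1)}} (begin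
    2 ^ (ℓ * K) * p ^ K          ≡⟨ cong (_* p ^ K) (sym (^-*-assoc 2 ℓ K)) ⟩
    (2 ^ ℓ) ^ K * p ^ K          ≡⟨ sym (^-distribʳ-* (2 ^ ℓ) p K) ⟩
    (2 ^ ℓ * p) ^ K              ≤⟨ ^-monoˡ-≤ K code ⟩
    (4 * q) ^ K                  ≡⟨ ^-distribʳ-* 4 q K ⟩
    4 ^ K * q ^ K                ≤⟨ *-monoʳ-≤ (4 ^ K) h ⟩
    4 ^ K * (2 ^ c * p ^ K)      ≡⟨ sym (*-assoc (4 ^ K) (2 ^ c) (p ^ K)) ⟩
    4 ^ K * 2 ^ c * p ^ K        ≡⟨ cong (λ z → z * 2 ^ c * p ^ K) (^-*-assoc 2 2 K) ⟩
    2 ^ (2 * K) * 2 ^ c * p ^ K  ≡⟨ cong (_* p ^ K) (sym (^-distribˡ-+-* 2 (2 * K) c)) ⟩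
    2 ^ (2 * K + c) * p ^ K      ∎))
  where open ≤-Reasoning

-- After stage `n` the text has at least `n * 2 ^ n` bits. Up to the end of the next stage the cost
-- is at most `16 * n * 2 ^ n` units once `n` exceeds the constants; divided by `K = 16 * k` this is
-- at most a fraction `1 / k` of the text.
eventually-small : (L : Str → ℕ) → (∀ y → 2 ^ L y * proj₁ (P y) ≤ 4 * proj₂ (P y)) →
  ∀ k C₀ c (x s : ℕ → Str) → 1 ≤ k → (∀ i → x (suc i) ≡ x i ++ s i) →
  (∀ i m → 4 + i ≤ m → len (3 + i) ≤ m → m < len (4 + i) → prefixS m ≡ x i ++ take (m ∸ len (3 + i)) (s i)) →
  StageBound (16 * k) c x s → Cost (16 * k) (P (x 0)) C₀ → ∃ λ M → ∀ m → M ≤ m → k * L (prefixS m) ≤ m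
eventually-small L code k C₀ c x s k≥1 x-suc split stage start = len n₁ , bound
  where
  K = 16 * k
  open Total K C₀ c x s x-suc stage start
  D = 2 * K + C₀
  -- From here on the constants `D + 4 + 4 * c` fit into `8 * n`, half of the budget `16 * n`.
  n₁ = 3 + (D + 4 + 4 * c)

  large : ∀ i m → D + 4 + 4 * c ≤ i → len (3 + i) ≤ m → m < len (4 + i) → k * L (prefixS m) ≤ m
  large i m i≥ l u = *-cancelʳ-≤ _ _ K {{>-nonZero (*-mono-≤ (s≤s (z≤n {15})) k≥1)}} (begin
    k * L (prefixS m) * K               ≡⟨ *-assoc k _ K ⟩
    k * (L (prefixS m) * K)             ≤⟨ *-monoʳ-≤ k (code-length≤cost K (P (prefixS m)) (L (prefixS m)) (Pgo-pos [] (prefixS m)) cost (code (prefixS m))) ⟩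
    k * (2 * K + (C₀ + (8 * n + 4 + 4 * c) * 2 ^ n))   ≡⟨ cong (k *_) (sym (+-assoc (2 * K) C₀ _)) ⟩
    k * (D + (8 * n + 4 + 4 * c) * 2 ^ n)              ≤⟨ *-monoʳ-≤ k (+-monoˡ-≤ _ (≤-trans (≤-reflexive (sym (*-identityʳ D))) (*-monoʳ-≤ D (m^n>0 2 n)))) ⟩
    k * (D * 2 ^ n + (8 * n + 4 + 4 * c) * 2 ^ n)      ≡⟨ lem k D n c (2 ^ n) ⟩
    k * (D + 4 + 4 * c + 8 * n) * 2 ^ n                ≤⟨ *-monoˡ-≤ (2 ^ n) (*-monoʳ-≤ k (+-monoˡ-≤ (8 * n) (≤-trans i≥ (≤-trans (m≤n+m i 3) (m≤m+n n (7 * n)))))) ⟩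
    k * (8 * n + 8 * n) * 2 ^ n                        ≡⟨ lem′ k n (2 ^ n) ⟩
    n * 2 ^ n * K                                      ≤⟨ *-monoˡ-≤ K (≤-trans (len-lower n) l) ⟩
    m * K                                              ∎)
    where
    open ≤-Reasoning
    n = 3 + i
    n<m : suc n ≤ m
    n<m = ≤-trans (+-monoˡ-≤ n (s≤s (z≤n {2 + i}))) (≤-trans (≤-reflexive (trans (double n) (*-comm 2 n)))
      (≤-trans (*-monoʳ-≤ n (^-monoʳ-≤ 2 (s≤s (z≤n {2 + i})))) (≤-trans (len-lower n) l)))
    cost : Cost K (P (prefixS m)) (C₀ + (8 * n + 4 + 4 * c) * 2 ^ n)
    cost = subst (λ z → Cost K (P z) (C₀ + (8 * n + 4 + 4 * c) * 2 ^ n)) (sym (split i m n<m l u)) (partial i (m ∸ len n))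
    lem : ∀ k D n c p → k * (D * p + (8 * n + 4 + 4 * c) * p) ≡ k * (D + 4 + 4 * c + 8 * n) * p
    lem = solve-∀
    lem′ : ∀ k n p → k * (8 * n + 8 * n) * p ≡ n * p * (16 * k)
    lem′ = solve-∀

  bound : ∀ m → len n₁ ≤ m → k * L (prefixS m) ≤ m
  bound m M≤ with n , l , u ← stage-of m = go n l u (≮⇒≥ λ n<n₁ → <⇒≱ u (≤-trans (len-mono n<n₁) M≤))
    where
    go : ∀ n → len n ≤ m → m < len (suc n) → n₁ ≤ n → k * L (prefixS m) ≤ m
    go (suc (suc (suc i))) l u (s≤s (s≤s (s≤s i≥))) = large i m i≥ l u

-- The two hypotheses on `L` are the bounds -log₂ P and -log₂ P + 2 on the code length, cleared of
-- logarithms and denominators; ranging over all `k` expresses that the upper limit is 0.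
theorem2 : (L : Str → ℕ)
    → (∀ y → proj₂ (P y) ≤ 2 ^ L y * proj₁ (P y))
    → (∀ y → 2 ^ L y * proj₁ (P y) ≤ 4 * proj₂ (P y))
    → ∀ k → 1 ≤ k → ∃ λ M → ∀ m → M ≤ m → k * L (prefixS m) ≤ m
theorem2 L _ upper k k≥1 =
  eventually-small L upper k _ _ (λ i → Sprefix (3 + i)) (λ i → Sblock (4 + i)) k≥1
    (λ i → Sprefix-suc (3 + i)) (λ i → prefixS-split (3 + i)) (cost-in-stage (16 * k)) (Cost-trivial (16 * k) (Sprefix 3))
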